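{- (The Immerman–Szelepcsényi Theorem) Let $S(n)\in\Omega(\log n)$. Then $\mathrm{NSPACE}(S(n))$ is closed under complement; in other words, $\mathrm{NSPACE}(S(n))=\text{co- }\mathrm{NSPACE}(S(n))$.
   Context: Turing machines have a two-way read-only input tape (with end-markers) and a two-way read-write work tape; only work tape cells count towards space. Space-bounded machines are assumed to halt on all computation paths, in a unique accepting or a unique rejecting state. A machine is $O(S(n))$-space bounded if on every input of length $n$ the number of work tape cells it reads or writes is $O(S(n))$. A nondeterministic machine $M$ accepts $x$ if at least one computation path on $x$ accepts, and $L(M)$ is the set of accepted strings. For an input alphabet $\Sigma$, $\mathrm{NSPACE}(S(n))$ is the class of languages $L\subseteq\Sigma^*$ such that $L=L(M)$ for some $O(S(n))$-space bounded nondeterministic Turing machine $M$, and $\text{co- }\mathrm{NSPACE}(S(n))=\{\Sigma^*\setminus L : L\in \mathrm{NSPACE}(S(n))\}$. -}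

module Defs where

open import Data.Fin.Base using (Fin; zero; suc; pred)
open import Data.List.Base using (List; []; _∷_; length)
open import Data.List.Membership.Propositional using () renaming (_∈_ to _∈ˡ_)
open import Data.List.NonEmpty.Base using (List⁺; toList)
open import Data.Nat.Base using (ℕ; suc; _+_; _*_; _≤_)
open import Data.Nat.Logarithm using (⌈log₂_⌉)
open import Data.Product.Base using (∃; ∃-syntax; _×_)
open import Data.Vec.Base as Vec using (Vec; fromList; lookup; _∷ʳ_)
open import Function.Base using (flip)
open import Function.Bundles using (_↔_)
open import Induction.WellFounded using (Acc)
open import Level using (0ℓ) renaming (suc to ℓsuc)
open import Relation.Binary.Construct.Closure.ReflexiveTransitive using (Star)
open import Relation.Binary.PropositionalEquality.Core using (_≡_)
open import Relation.Unary using (Pred; _∈_; _≐_; ∁)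

Finite : Set → Set
Finite A = ∃[ n ] (A ↔ Fin n)

infix 4 _∈O_ _∈Ω_

_∈O_ : (ℕ → ℕ) → (ℕ → ℕ) → Set
f ∈O g = ∃[ c ] ∃[ n₀ ] (∀ n → n₀ ≤ n → f n ≤ c * g n)

_∈Ω_ : (ℕ → ℕ) → (ℕ → ℕ) → Set
f ∈Ω g = g ∈O f

-- Rounding up only changes log₂ by a bounded factor for n ≥ 2, so Ω(log n)
-- does not depend on it.
log : ℕ → ℕ
log n = ⌈log₂ n ⌉

data Move : Set where
  left stay right : Move

data InputSymbol (Σ : Set) : Set where
  ⊢ ⊣ : InputSymbol Σ
  sym : Σ → InputSymbol Σ

-- `accept` and `reject` are the only halting states; `run q` is never halting.
data State (Q : Set) : Set where
  run           : Q → State Q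
  accept reject : State Q

record Action (Q Γ : Set) : Set where
  constructor action
  field
    next      : State Q
    inputMove : Move
    write     : Γ
    workMove  : Move

-- δ always offers at least one action, so a computation can only end in
-- `accept` or `reject`.
record NTM (Σ : Set) : Set₁ where
  field
    Q        : Set
    Q-finite : Finite Q
    Γ        : Set
    Γ-finite : Finite Γ
    blank    : Γ
    start    : Q
    δ        : Q → InputSymbol Σ → Γ → List⁺ (Action Q Γ)

inputTape : {Σ : Set} (x : List Σ) → Vec (InputSymbol Σ) (suc (suc (length x)))
inputTape x = ⊢ Vec.∷ (Vec.map sym (fromList x) ∷ʳ ⊣)

-- The input head stays put when told to leave the end-marked input.
next-cell : ∀ {n} → Fin n → Fin n
next-cell {suc (suc n)} zero    = suc zero
next-cell {suc ℕ.zero}  zero    = zero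
next-cell               (suc i) = suc (next-cell i)

moveInput : ∀ {n} → Move → Fin n → Fin n
moveInput left  = pred
moveInput stay  = λ i → i
moveInput right = next-cell

-- A two-way infinite work tape, storing exactly the contiguous block of cells
-- the head has visited.  All other cells are blank.  `before` and `after` list
-- the visited cells on either side of the head, nearest first.
record WorkTape (Γ : Set) : Set where
  constructor tape
  field
    before : List Γ
    head   : Γ
    after  : List Γ

cells : {Γ : Set} → WorkTape Γ → ℕ
cells (tape ls _ rs) = length ls + suc (length rs)

writeTape : {Γ : Set} → Γ → WorkTape Γ → WorkTape Γ
writeTape b (tape ls _ rs) = tape ls b rs

-- Moving off the visited block extends it by one blank cell.
moveTape : {Γ : Set} → Γ → Move → WorkTape Γ → WorkTape Γ
moveTape blank left  (tape []       a rs)       = tape [] blank (a ∷ rs)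
moveTape blank left  (tape (l ∷ ls) a rs)       = tape ls l (a ∷ rs)
moveTape blank stay  t                          = t
moveTape blank right (tape ls       a [])       = tape (a ∷ ls) blank []
moveTape blank right (tape ls       a (r ∷ rs)) = tape (a ∷ ls) r rs

module Computation {Σ : Set} (M : NTM Σ) (x : List Σ) where
  open NTM M

  record Config : Set where
    constructor config
    field
      state     : State Q
      inputHead : Fin (suc (suc (length x)))
      work      : WorkTape Γ

  initial : Config
  initial = config (run start) zero (tape [] blank [])

  perform : Action Q Γ → Fin (suc (suc (length x))) → WorkTape Γ → Config
  perform (action s d b e) i t =
    config s (moveInput d i) (moveTape blank e (writeTape b t))

  infix 4 _⟶_ _⟶*_

  data _⟶_ : Config → Config → Set where
    step : ∀ {q i t a} →
           a ∈ˡ toList (δ q (lookup (inputTape x) i) (WorkTape.head t)) →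
           config (run q) i t ⟶ perform a i t

  _⟶*_ : Config → Config → Set
  _⟶*_ = Star _⟶_

  Accepts : Set
  Accepts = ∃[ κ ] (initial ⟶* κ × Config.state κ ≡ accept)

  -- Every computation path from the initial configuration is finite.
  Halts : Set
  Halts = Acc (flip _⟶_) initial

  space : Config → ℕ
  space κ = cells (Config.work κ)

Language : Set → Set₁
Language Σ = Pred (List Σ) 0ℓ

module _ {Σ : Set} where

  L⟨_⟩ : NTM Σ → Language Σ
  L⟨ M ⟩ x = Computation.Accepts M x

  AlwaysHalts : NTM Σ → Set
  AlwaysHalts M = ∀ x → Computation.Halts M x

  -- The number of visited cells never decreases along a path, so bounding it
  -- at all reachable configurations bounds the space of all paths.
  SpaceBounded : (ℕ → ℕ) → NTM Σ → Set
  SpaceBounded S M = ∃[ s ] (s ∈O S × (∀ x κ → let open Computation M x in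
                                        initial ⟶* κ → space κ ≤ s (length x)))

  NSPACE : (ℕ → ℕ) → Pred (Language Σ) (ℓsuc 0ℓ)
  NSPACE S L = ∃[ M ] (AlwaysHalts M × SpaceBounded S M × L ≐ L⟨ M ⟩)

  co-NSPACE : (ℕ → ℕ) → Pred (Language Σ) (ℓsuc 0ℓ)
  co-NSPACE S L = ∃[ L′ ] (L′ ∈ NSPACE S × L ≐ ∁ L′)

{-# OPTIONS --safe #-}
module Submission where

-- Inductive counting.  Let M halt on x, and restrict M to a block of its work
-- tape.  Given the number c of configurations reachable in exactly d steps, the
-- complementing machine recognises that v is not reachable in d + 1 steps by
-- guessing c configurations in increasing order, with a path of length d to each,
-- and checking that none of them steps to v; counting the remaining v gives the
-- next c.  As M halts, c is eventually 0, and then x is not accepted unless M has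
-- left the block.  Whenever a simulated path leaves the block, or moves the input
-- head to a position with more binary digits than the block has cells, the block
-- grows by a cell on either side and the counting starts afresh, so S need not
-- be constructible.
--
-- Soundness and termination (on all paths) and completeness (on some path) of the
-- complementing machine follow from one argument, stated for a `Mode`.

open import Defs
open import Data.Bool.Base using (Bool; true; false; if_then_else_)
open import Data.Fin.Base as Fin using (Fin; zero; suc; toℕ; fromℕ; fromℕ<; inject₁)
open import Data.Fin.Patterns using (0F; 1F; 2F; 3F; 4F; 5F; 6F; 7F; 8F; 9F)
open import Data.Fin.Properties as Fin using (+↔⊎; *↔×; toℕ<n; toℕ-injective; toℕ-fromℕ<; toℕ-fromℕ; toℕ-inject₁; 2↔Bool; pigeonhole)
open import Data.List.Base as List using (List; []; _∷_; length; map; replicate; zipWith; _++_; reverse; _ʳ++_; concatMap; allFin)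
open import Data.List.Membership.Propositional using (find; lose) renaming (_∈_ to _∈ˡ_)
open import Data.List.Membership.Propositional.Properties using (∈-map⁺; ∈-map⁻; ∈-concatMap⁺; ∈-concatMap⁻; ∈-allFin; ∈-tabulate⁺)
open import Data.List.NonEmpty.Base as List⁺ using (List⁺; toList) renaming (_∷_ to _∷⁺_)
open import Data.List.Properties using (length-map; length-replicate; map-replicate; ∷-injective; length-reverse; map-ʳ++; length-ʳ++; ʳ++-defn; length-++; map-++; reverse-map; ++-assoc; length-zipWith; map-∘; map-id; reverse-involutive; map-cong; ʳ++-ʳ++; ++-identityʳ; unfold-reverse)
open import Data.List.Relation.Unary.Any as Any using (Any; here; there)
open import Data.Maybe.Base using (Maybe; just; nothing)
open import Data.Maybe.Properties using (just-injective)
open import Data.Nat.Base using (ℕ; zero; suc; _+_; _*_; _^_; _∸_; _⊔_; _≤_; _<_; z≤n; s≤s; _⊓_)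
open import Data.Nat.DivMod using (_%_; [m+kn]%n≡m%n; m<n⇒m%n≡m)
open import Data.Nat.Logarithm using (⌈log₂⌉-mono-≤; ⌈log₂2*n⌉≡1+⌈log₂n⌉; ⌈log₂2^n⌉≡n)
open import Data.Nat.Properties
open import Data.Nat.Solver using (module +-*-Solver)
open import Data.Product.Base using (∃-syntax; _×_; _,_; proj₁; proj₂)
open import Data.Product.Function.NonDependent.Propositional using (_×-↔_)
open import Data.Sum.Base using (_⊎_; inj₁; inj₂)
open import Data.Sum.Function.Propositional using (_⊎-↔_)
open import Data.Unit.Base using (tt)
open import Data.Vec.Base as Vec using (Vec; lookup; _[_]≔_; fromList; _∷ʳ_)
open import Data.Vec.Properties using (lookup∘update; lookup∘update′; lookup-replicate)
open import Function.Base using (_∘_; id; const)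
open import Function.Bundles using (_↔_; mk↔ₛ′; Inverse)
open import Function.Properties.Inverse using (↔-refl; ↔-sym; ↔-trans)
open import Induction.WellFounded using (Acc; acc)
open import Relation.Binary.Construct.Closure.ReflexiveTransitive using (ε; _◅_)
open import Relation.Binary.Definitions using (DecidableEquality)
open import Relation.Binary.PropositionalEquality renaming (sym to ≡-sym)
open import Relation.Nullary using (¬_; Dec; yes; no; contradiction)
open import Relation.Unary using (_∈_; _≐_; ∁)

-- All data share one tape: the simulated configuration, its input position and seven counters are
-- tracks of a single word, so the machine works in sweeps over that word and its control holds only
-- the current instruction. A configuration is itself a numeral, one nonzero digit per cell, so that
-- comparing it with a counter takes one sweep. Since the input position is part of the
-- configuration, it too must fit into the block. This is where `S ∈Ω log` enters: a block with more
-- than `log (n + 1)` cells has room for it.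
--
-- Simulating an action overwrites the simulated configuration. Hence one guessed path tests a
-- single successor, and the pass over all u is repeated for every choice k and every candidate v.
--
-- The correctness argument runs backwards along the program: a label is `Ready` as soon as the
-- labels that may follow it are, and each loop becomes an induction on the number of iterations
-- left. No measure on configurations of the complementing machine is needed.

private variable
  A X T : Set

-- Finite types

finite-↔ : A ↔ X → Finite X → Finite A
finite-↔ f (n , g) = n , ↔-trans f g

finite-Fin : ∀ n → Finite (Fin n)
finite-Fin n = n , ↔-refl

finite-⊎ : Finite A → Finite X → Finite (A ⊎ X)
finite-⊎ (m , f) (n , g) = m + n , ↔-trans (f ⊎-↔ g) (↔-sym +↔⊎)

finite-× : Finite A → Finite X → Finite (A × X)
finite-× (m , f) (n , g) = m * n , ↔-trans (f ×-↔ g) (↔-sym *↔×)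

finite-Maybe : Finite A → Finite (Maybe A)
finite-Maybe fA = finite-↔
  (mk↔ₛ′ (λ { nothing → inj₁ zero ; (just a) → inj₂ a })
         (λ { (inj₁ zero) → nothing ; (inj₂ a) → just a })
         (λ { (inj₁ zero) → refl ; (inj₂ a) → refl })
         (λ { nothing → refl ; (just a) → refl }))
  (finite-⊎ (finite-Fin 1) fA)

finite-Vec : ∀ n → Finite A → Finite (Vec A n)
finite-Vec zero fA = finite-↔
  (mk↔ₛ′ (λ _ → zero) (λ _ → Vec.[]) (λ { zero → refl }) (λ { Vec.[] → refl }))
  (finite-Fin 1)
finite-Vec (suc n) fA = finite-↔
  (mk↔ₛ′ Vec.uncons (λ p → proj₁ p Vec.∷ proj₂ p)
         (λ _ → refl) (λ { (_ Vec.∷ _) → refl }))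
  (finite-× fA (finite-Vec n fA))

finite-Move : Finite Move
finite-Move = 3 , mk↔ₛ′
  (λ { left → zero ; stay → suc zero ; right → suc (suc zero) })
  (λ { zero → left ; (suc zero) → stay ; (suc (suc zero)) → right })
  (λ { zero → refl ; (suc zero) → refl ; (suc (suc zero)) → refl })
  (λ { left → refl ; stay → refl ; right → refl })

finite-InputSymbol : Finite A → Finite (InputSymbol A)
finite-InputSymbol fA = finite-↔
  (mk↔ₛ′ (λ { ⊢ → inj₁ zero ; ⊣ → inj₁ (suc zero) ; (sym a) → inj₂ a })
         (λ { (inj₁ zero) → ⊢ ; (inj₁ (suc zero)) → ⊣ ; (inj₂ a) → sym a })
         (λ { (inj₁ zero) → refl ; (inj₁ (suc zero)) → refl ; (inj₂ a) → refl })
         (λ { ⊢ → refl ; ⊣ → refl ; (sym a) → refl }))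
  (finite-⊎ (finite-Fin 2) fA)

to-injective : (f : A ↔ X) → ∀ {a a′} → Inverse.to f a ≡ Inverse.to f a′ → a ≡ a′
to-injective f {a} {a′} eq =
  trans (≡-sym (Inverse.strictlyInverseʳ f a))
        (trans (cong (Inverse.from f) eq) (Inverse.strictlyInverseʳ f a′))

Fin-bounded : ∀ n (f : Fin n → ℕ) → ∃[ m ] (∀ i → f i ≤ m)
Fin-bounded zero    f = 0 , λ ()
Fin-bounded (suc n) f with Fin-bounded n (f ∘ suc)
... | m , f≤m = f zero ⊔ m , λ where
  zero    → m≤m⊔n (f zero) m
  (suc i) → ≤-trans (f≤m i) (m≤n⊔m (f zero) m)

finite-bounded : Finite A → (f : A → ℕ) → ∃[ m ] (∀ a → f a ≤ m)
finite-bounded (n , g) f with Fin-bounded n (f ∘ Inverse.from g)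
... | m , f≤m = m , λ a →
  subst (λ a′ → f a′ ≤ m) (Inverse.strictlyInverseʳ g a) (f≤m (Inverse.to g a))

nth : List A → ℕ → Maybe A
nth []       _       = nothing
nth (x ∷ xs) zero    = just x
nth (x ∷ xs) (suc n) = nth xs n

nth-∈ : ∀ (xs : List A) n {x} → nth xs n ≡ just x → x ∈ˡ xs
nth-∈ (x ∷ xs) zero    refl = here refl
nth-∈ (x ∷ xs) (suc n) eq   = there (nth-∈ xs n eq)

∈-nth : ∀ {xs : List A} {x} → x ∈ˡ xs → ∃[ n ] (n < length xs × nth xs n ≡ just x)
∈-nth (here refl) = 0 , s≤s z≤n , refl
∈-nth (there x∈) with ∈-nth x∈
... | n , n< , eq = suc n , s≤s n< , eq

-- Mealy machines scanning a word

end : (T → A → T × X) → T → List A → T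
end δ s []      = s
end δ s (a ∷ w) = end δ (proj₁ (δ s a)) w

out : (T → A → T × X) → T → List A → List X
out δ s []      = []
out δ s (a ∷ w) = proj₂ (δ s a) ∷ out δ (proj₁ (δ s a)) w

length-out : ∀ (δ : T → A → T × X) s w → length (out δ s w) ≡ length w
length-out δ s []      = refl
length-out δ s (a ∷ w) = cong suc (length-out δ _ w)

length-reverse-out : ∀ (δ : T → A → T × X) s w → length (reverse (out δ s w)) ≡ length w
length-reverse-out δ s w = trans (length-reverse (out δ s w)) (length-out δ s w)

module _ {δ : T → A → T × A} {δ′ : T → X → T × X} (get : A → X)
         (δ≈ : ∀ s a → (proj₁ (δ s a) ≡ proj₁ (δ′ s (get a)))
                     × (get (proj₂ (δ s a)) ≡ proj₂ (δ′ s (get a)))) where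

  -- A scan that depends on one component of the letters is, seen through `get`, a scan of that
  -- track alone. This carries facts about numerals and cell words over to the tape.
  end-track : ∀ s w → end δ s w ≡ end δ′ s (map get w)
  end-track s []      = refl
  end-track s (a ∷ w) =
    trans (end-track _ w) (cong (λ t → end δ′ t (map get w)) (proj₁ (δ≈ s a)))

  out-track : ∀ s w → map get (out δ s w) ≡ out δ′ s (map get w)
  out-track s []      = refl
  out-track s (a ∷ w) = cong₂ _∷_ (proj₂ (δ≈ s a))
    (trans (out-track _ w) (cong (λ t → out δ′ t (map get w)) (proj₁ (δ≈ s a))))

out-frame : ∀ {δ : T → A → T × A} (get : A → X) →
            (∀ s a → get (proj₂ (δ s a)) ≡ get a) →
            ∀ s w → map get (out δ s w) ≡ map get w
out-frame get eq s []      = refl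
out-frame get eq s (a ∷ w) = cong₂ _∷_ (eq s a) (out-frame get eq _ w)

module _ {δ : T → A → T × A} {s : T} (idle : ∀ a → δ s a ≡ (s , a)) where

  end-idle : ∀ w → end δ s w ≡ s
  end-idle []      = refl
  end-idle (a ∷ w) rewrite idle a = end-idle w

  out-idle : ∀ w → out δ s w ≡ w
  out-idle []      = refl
  out-idle (a ∷ w) rewrite idle a = cong (a ∷_) (out-idle w)

module _ (δ : T → A → T × X) (f : A → X) {s : T} (δ≗f : ∀ a → δ s a ≡ (s , f a)) where

  end-map : ∀ w → end δ s w ≡ s
  end-map []      = refl
  end-map (a ∷ w) rewrite δ≗f a = end-map w

  out-map : ∀ w → out δ s w ≡ map f w
  out-map []      = refl
  out-map (a ∷ w) rewrite δ≗f a = cong (f a ∷_) (out-map w)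

-- One type of states serves all scans; each of them starts in `on`.
data Status (Q : Set) : Set where
  on off dead accepting : Status Q
  moved           : Move → Move → Status Q
  holding         : Q → Status Q

finite-Status : Finite A → Finite (Status A)
finite-Status fQ = finite-↔
  (mk↔ₛ′ (λ { on → inj₁ zero ; off → inj₁ (suc zero) ; dead → inj₁ (suc (suc zero))
            ; accepting → inj₁ (suc (suc (suc zero))) ; (moved d e) → inj₂ (inj₁ (d , e))
            ; (holding q) → inj₂ (inj₂ q) })
         (λ { (inj₁ zero) → on ; (inj₁ (suc zero)) → off ; (inj₁ (suc (suc zero))) → dead
            ; (inj₁ (suc (suc (suc zero)))) → accepting ; (inj₂ (inj₁ (d , e))) → moved d e
            ; (inj₂ (inj₂ q)) → holding q })
         (λ { (inj₁ zero) → refl ; (inj₁ (suc zero)) → refl ; (inj₁ (suc (suc zero))) → refl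
            ; (inj₁ (suc (suc (suc zero)))) → refl ; (inj₂ (inj₁ (d , e))) → refl
            ; (inj₂ (inj₂ q)) → refl })
         (λ { on → refl ; off → refl ; dead → refl ; accepting → refl
            ; (moved d e) → refl ; (holding q) → refl }))
  (finite-⊎ (finite-Fin 4) (finite-⊎ (finite-× finite-Move finite-Move) fQ))

module _ {Q : Set} {E : Set} (_≟_ : DecidableEquality E) (f g : A → E) where

  eqδ : Status Q → A → Status Q × A
  eqδ on a with f a ≟ g a
  ... | yes _ = on , a
  ... | no _  = off , a
  eqδ s a = s , a

  eqδ-idle : ∀ s a → proj₂ (eqδ s a) ≡ a
  eqδ-idle on a with f a ≟ g a
  ... | yes _ = refl
  ... | no _  = refl
  eqδ-idle off           a = refl
  eqδ-idle dead          a = refl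
  eqδ-idle accepting         a = refl
  eqδ-idle (moved _ _)   a = refl
  eqδ-idle (holding _)   a = refl

  out-eq : ∀ s w → out eqδ s w ≡ w
  out-eq s []      = refl
  out-eq s (a ∷ w) = cong₂ _∷_ (eqδ-idle s a) (out-eq _ w)

  end-eq : ∀ w → (end eqδ on w ≡ on × map f w ≡ map g w)
               ⊎ (end eqδ on w ≡ off × map f w ≢ map g w)
  end-eq [] = inj₁ (refl , refl)
  end-eq (a ∷ w) with f a ≟ g a
  ... | no f≢g  = inj₂ (end-idle (λ _ → refl) w , λ eq → f≢g (proj₁ (∷-injective eq)))
  ... | yes f≡g with end-eq w
  ...   | inj₁ (e , eq)  = inj₁ (e , cong₂ _∷_ f≡g eq)
  ...   | inj₂ (e , neq) = inj₂ (e , λ eq → neq (proj₂ (∷-injective eq)))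

-- Numerals in base `suc m`, least significant digit first

module _ {Q : Set} {m : ℕ} where

  private
    b = suc m

  -- The status `on` doubles as the pending carry, and in `digit-pred` as the pending borrow.
  digit-suc : Fin b → Status Q × Fin b
  digit-suc i with toℕ i <? m
  ... | yes i<m = off , fromℕ< (s≤s i<m)
  ... | no  _   = on , zero

  digit-pred : Fin b → Status Q × Fin b
  digit-pred zero    = on , fromℕ m
  digit-pred (suc i) = off , inject₁ i

  incδ : Status Q → Fin b → Status Q × Fin b
  incδ on i = digit-suc i
  incδ s  i = s , i

  decδ : Status Q → Fin b → Status Q × Fin b
  decδ on i = digit-pred i
  decδ s  i = s , i

module Numeral (Q : Set) (m : ℕ) where

  private
    b = suc m

  inc : List (Fin b) → List (Fin b)
  inc = out (incδ {Q}) on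

  value : List (Fin b) → ℕ
  value []      = 0
  value (i ∷ w) = toℕ i + value w * b

  value< : ∀ w → value w < b ^ length w
  value< []      = s≤s z≤n
  value< (i ∷ w) = begin-strict
    toℕ i + value w * b <⟨ +-monoˡ-< (value w * b) (toℕ<n i) ⟩
    suc (value w) * b   ≤⟨ *-monoˡ-≤ b (value< w) ⟩
    b ^ length w * b    ≡⟨ *-comm (b ^ length w) b ⟩
    b * b ^ length w    ∎
    where open ≤-Reasoning

  -- Reduction modulo the base recovers the lowest digit; cancelling it leaves the same equation for
  -- the remaining digits.
  value-injective : ∀ w w′ → length w ≡ length w′ → value w ≡ value w′ → w ≡ w′
  value-injective []      []        _ _  = refl
  value-injective (i ∷ w) (i′ ∷ w′) l eq
    = cong₂ _∷_ (toℕ-injective i≡i′)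
        (value-injective w w′ (suc-injective l)
          (*-cancelʳ-≡ (value w) (value w′) b (+-cancelˡ-≡ (toℕ i) _ _
            (trans eq (cong (_+ value w′ * b) (≡-sym i≡i′))))))
    where
    mod : ∀ (j : Fin b) v → (toℕ j + v * b) % b ≡ toℕ j
    mod j v = trans ([m+kn]%n≡m%n (toℕ j) v b) (m<n⇒m%n≡m (toℕ<n j))
    i≡i′ : toℕ i ≡ toℕ i′
    i≡i′ = trans (≡-sym (mod i (value w))) (trans (cong (_% b) eq) (mod i′ (value w′)))

  -- A final `on` is a carry out of the last digit, so the old value was the largest of its length.
  -- The counting loops of the machine end on this signal.
  inc-value : ∀ w → (end (incδ {Q}) on w ≡ off × value (inc w) ≡ suc (value w))
                  ⊎ (end (incδ {Q}) on w ≡ on × suc (value w) ≡ b ^ length w)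
  inc-value [] = inj₂ (refl , refl)
  inc-value (i ∷ w) with toℕ i <? m
  ... | yes i<m = inj₁ (end-idle (λ _ → refl) w ,
    cong₂ (λ x w′ → x + value w′ * b) (toℕ-fromℕ< (s≤s i<m)) (out-idle (λ _ → refl) w))
  ... | no  i≮m with ≤-antisym (≤-pred (toℕ<n i)) (≮⇒≥ i≮m)
  ...   | i≡m with inc-value w
  ...     | inj₁ (e , v) = inj₁ (e , trans (cong (_* b) v) (cong (λ x → suc (x + value w * b)) (≡-sym i≡m)))
  ...     | inj₂ (e , v) = inj₂ (e , trans (cong (λ x → suc (x + value w * b)) i≡m)
                                     (trans (cong (_* b) v) (*-comm (b ^ length w) b)))

  inc-overflow : ∀ w → end (incδ {Q}) on w ≡ on → inc w ≡ replicate (length w) zero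
  inc-overflow []      _  = refl
  inc-overflow (i ∷ w) eq with toℕ i <? m
  ... | yes _ = contradiction (trans (≡-sym (end-idle {δ = incδ {Q}} (λ _ → refl) w)) eq) λ ()
  ... | no  _ = cong (zero ∷_) (inc-overflow w eq)

  -- Iterating the machine's own increment makes the effect of an incrementing sweep hold by
  -- definition. Beyond the largest value it wraps around to zero.
  numeral : ℕ → ℕ → List (Fin b)
  numeral l zero    = replicate l zero
  numeral l (suc n) = inc (numeral l n)

  length-numeral : ∀ l n → length (numeral l n) ≡ l
  length-numeral l zero    = length-replicate l
  length-numeral l (suc n) = trans (length-out incδ on (numeral l n)) (length-numeral l n)

  value-zero : ∀ l → value (replicate l zero) ≡ 0
  value-zero zero    = refl
  value-zero (suc l) = cong (_* b) (value-zero l)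

  value-numeral : ∀ l n → n < b ^ l → value (numeral l n) ≡ n
  value-numeral l zero    n< = value-zero l
  value-numeral l (suc n) n< with inc-value (numeral l n)
  ... | inj₁ (_ , v) = trans v (cong suc (value-numeral l n (<⇒≤ n<)))
  ... | inj₂ (_ , v) = contradiction
    (trans (≡-sym (cong suc (value-numeral l n (<⇒≤ n<))))
           (trans v (cong (b ^_) (length-numeral l n)))) (<⇒≢ n<)

  numeral-value : ∀ w → numeral (length w) (value w) ≡ w
  numeral-value w = value-injective _ w (length-numeral _ (value w))
    (value-numeral _ (value w) (value< w))

  numeral-injective : ∀ l {n n′} → n < b ^ l → n′ < b ^ l → numeral l n ≡ numeral l n′ → n ≡ n′
  numeral-injective l {n} {n′} n< n′< eq =
    trans (≡-sym (value-numeral l n n<)) (trans (cong value eq) (value-numeral l n′ n′<))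

  end-inc-< : ∀ l n → suc n < b ^ l → end (incδ {Q}) on (numeral l n) ≡ off
  end-inc-< l n n< with inc-value (numeral l n)
  ... | inj₁ (e , _) = e
  ... | inj₂ (_ , v) = contradiction
    (trans (≡-sym (cong suc (value-numeral l n (<⇒≤ n<))))
           (trans v (cong (b ^_) (length-numeral l n)))) (<⇒≢ n<)

  end-inc-≡ : ∀ l n → suc n ≡ b ^ l → end (incδ {Q}) on (numeral l n) ≡ on
  end-inc-≡ l n n≡ with inc-value (numeral l n)
  ... | inj₂ (e , _) = e
  ... | inj₁ (_ , v) = contradiction
    (subst (_< b ^ length (inc (numeral l n))) v (value< (inc (numeral l n))))
    (≤⇒≯ (≤-reflexive (trans (cong (b ^_) (length-numeral l (suc n)))
      (trans (≡-sym n≡) (cong suc (≡-sym (value-numeral l n (≤-reflexive n≡))))))))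

  -- The borrow passes through exactly those digits that the carry has reset to zero.
  dec-inc : ∀ w → out (decδ {Q}) on (inc w) ≡ w
  dec-inc []      = refl
  dec-inc (i ∷ w) with toℕ i <? m
  ... | no  i≮m = cong₂ _∷_ (toℕ-injective (trans (toℕ-fromℕ m)
                    (≤-antisym (≮⇒≥ i≮m) (≤-pred (toℕ<n i))))) (dec-inc w)
  ... | yes i<m = cong₂ _∷_
    (toℕ-injective (trans (toℕ-inject₁ _) (toℕ-fromℕ< i<m)))
    (trans (out-idle (λ _ → refl) _) (out-idle (λ _ → refl) w))

-- Sweeping machines

record Outcome (L B : Set) : Set where
  constructor outcome
  field
    extension : Maybe B
    next      : State L
    move      : Move

cons? : {B : Set} → Maybe B → List B → List B
cons? nothing  w = w
cons? (just b) w = b ∷ w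

-- A machine whose work tape holds a word over B between blanks.  In a round
-- with label l it scans the word rightwards with δR l, possibly appends a
-- letter, scans it leftwards with δL l and then decides, from the state of the
-- scan and the input symbol under the input head, whether to prepend a letter,
-- how to move the input head and which round comes next.
record Sweeper (Σ : Set) : Set₁ where
  field
    L S B    : Set
    L-finite : Finite L
    S-finite : Finite S
    B-finite : Finite B
    first    : L
    on₀      : S
    δR δL    : L → S → B → S × B
    append   : L → Maybe B
    decide   : L → S → InputSymbol Σ → List⁺ (Outcome L B)

data Mode : Set where
  every some : Mode

module Sweep {Σ : Set} (P : Sweeper Σ) where
  open Sweeper P

  data Control : Set where
    goR goL : L → S → Control

  finite-Control : Finite Control
  finite-Control = finite-↔
    (mk↔ₛ′ (λ { (goR l s) → inj₁ (l , s) ; (goL l s) → inj₂ (l , s) })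
           (λ { (inj₁ (l , s)) → goR l s ; (inj₂ (l , s)) → goL l s })
           (λ { (inj₁ (l , s)) → refl ; (inj₂ (l , s)) → refl })
           (λ { (goR l s) → refl ; (goL l s) → refl }))
    (finite-⊎ (finite-× L-finite S-finite) (finite-× L-finite S-finite))

  begin-round : State L → State Control
  begin-round (run l) = run (goR l on₀)
  begin-round accept  = accept
  begin-round reject  = reject

  -- The leftward scan stops on the blank just before the word, so a prepended letter replaces that
  -- blank, whereas otherwise the head steps back onto the word.
  toAction : Outcome L B → Action Control (Maybe B)
  toAction (outcome nothing  l d) = action (begin-round l) d nothing right
  toAction (outcome (just b) l d) = action (begin-round l) d (just b) stay

  turn : L → S → Maybe B → Action Control (Maybe B)
  turn l s nothing  = action (run (goL l s)) stay nothing left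
  turn l s (just b) = action (run (goL l s)) stay (just b) stay

  program : Control → InputSymbol Σ → Maybe B → List⁺ (Action Control (Maybe B))
  program (goR l s) σ (just b) =
    action (run (goR l (proj₁ (δR l s b)))) stay (just (proj₂ (δR l s b))) right ∷⁺ []
  program (goR l s) σ nothing  = turn l s (append l) ∷⁺ []
  program (goL l s) σ (just b) =
    action (run (goL l (proj₁ (δL l s b)))) stay (just (proj₂ (δL l s b))) left ∷⁺ []
  program (goL l s) σ nothing  = List⁺.map toAction (decide l s σ)

  machine : NTM Σ
  machine = record
    { Q = Control ; Q-finite = finite-Control
    ; Γ = Maybe B ; Γ-finite = finite-Maybe B-finite
    ; blank = nothing ; start = goR first on₀ ; δ = program }

  rightState : L → List B → S
  rightState l w = end (δR l) on₀ w

  turned : L → List B → List B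
  turned l w = cons? (append l) (reverse (out (δR l) on₀ w))

  finalState : L → List B → S
  finalState l w = end (δL l) (rightState l w) (turned l w)

  finalWord : L → List B → List B
  finalWord l w = reverse (out (δL l) (rightState l w) (turned l w))

  -- Winning a computation of a sweeping machine

  module Rounds (x : List Σ) (bound : ℕ) (Goal : Set) where
    open Computation machine x

    -- Being inductive, the predicate also contains the well-foundedness of the computation, so
    -- termination on all paths needs no separate proof.
    data Safe (κ : Config) : Set where
      safe : space κ ≤ bound → (Config.state κ ≡ accept → Goal) →
             (∀ {κ′} → κ ⟶ κ′ → Safe κ′) → Safe κ

    Wins : Mode → Config → Set
    Wins every κ = Safe κ
    Wins some  κ = ∃[ κ′ ] (κ ⟶* κ′ × Config.state κ′ ≡ accept)

    Branch : Mode → {A : Set} → (A → Set) → List⁺ A → Set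
    Branch every P as = ∀ a → a ∈ˡ toList as → P a
    Branch some  P as = ∃[ a ] (a ∈ˡ toList as × P a)

    wins-step : ∀ m {q i t} → cells t ≤ bound →
                Branch m (λ a → Wins m (perform a i t))
                       (program q (lookup (inputTape x) i) (WorkTape.head t)) →
                Wins m (config (run q) i t)
    wins-step every c≤ all = safe c≤ (λ ()) λ { (step a∈) → all _ a∈ }
    wins-step some  c≤ (a , a∈ , κ′ , steps , won) = κ′ , step a∈ ◅ steps , won

    -- With a single successor the universal and the existential reading of a branch coincide, so
    -- deterministic steps need no case distinction on the mode.
    wins-det : ∀ m {q i t a} → cells t ≤ bound →
               program q (lookup (inputTape x) i) (WorkTape.head t) ≡ (a ∷⁺ []) →
               Wins m (perform a i t) → Wins m (config (run q) i t)
    wins-det m c≤ eq w = wins-step m c≤ (branch m (subst-branch eq w))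
      where
      subst-branch : ∀ {as a} {R : Action Control (Maybe B) → Set} → as ≡ (a ∷⁺ []) → R a →
                     (∀ a′ → a′ ∈ˡ toList as → R a′) × (∃[ a′ ] (a′ ∈ˡ toList as × R a′))
      subst-branch refl r = (λ { _ (here refl) → r }) , _ , here refl , r
      branch : ∀ m {as} {R : Action Control (Maybe B) → Set} →
               (∀ a′ → a′ ∈ˡ toList as → R a′) × (∃[ a′ ] (a′ ∈ˡ toList as × R a′)) →
               Branch m R as
      branch every = proj₁
      branch some  = proj₂

    atR : List (Maybe B) → List (Maybe B) → WorkTape (Maybe B)
    atR ls []       = tape ls nothing []
    atR ls (r ∷ rs) = tape ls r rs

    atL : List (Maybe B) → List (Maybe B) → WorkTape (Maybe B)
    atL []       rs = tape [] nothing rs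
    atL (l ∷ ls) rs = tape ls l rs

    move-right : ∀ ls a rs → moveTape nothing right (tape ls a rs) ≡ atR (a ∷ ls) rs
    move-right ls a []       = refl
    move-right ls a (r ∷ rs) = refl

    move-left : ∀ ls a rs → moveTape nothing left (tape ls a rs) ≡ atL ls (a ∷ rs)
    move-left []       a rs = refl
    move-left (l ∷ ls) a rs = refl

    blanks : Bool → List (Maybe B)
    blanks false = []
    blanks true  = nothing ∷ []

    length-blanks : ∀ c → length (blanks c) ≤ 1
    length-blanks false = z≤n
    length-blanks true  = s≤s z≤n

    right-end : ∀ ls c → atR ls (blanks c) ≡ tape ls nothing []
    right-end ls false = refl
    right-end ls true  = refl

    left-end : ∀ c rs → atL (blanks c) rs ≡ tape [] nothing rs
    left-end false rs = refl
    left-end true  rs = refl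

    -- The `suc` in the space hypothesis pays for the fresh blank that the head enters when nothing
    -- is stored behind the word.
    scan-right : ∀ m l i w ls rs s → length ls + (length w + suc (length rs)) ≤ bound →
      Wins m (config (run (goR l (end (δR l) s w))) i
                     (atR (map just (out (δR l) s w) ʳ++ ls) rs)) →
      Wins m (config (run (goR l s)) i (atR ls (map just w ++ rs)))
    scan-right m l i []      ls rs s c≤ wins = wins
    scan-right m l i (b ∷ w) ls rs s c≤ wins =
      wins-det m (≤-trans (+-monoʳ-≤ (length ls) (s≤s (≤-trans (≤-reflexive
          (trans (length-++ (map just w)) (cong (_+ length rs) (length-map just w))))
          (+-monoʳ-≤ (length w) (n≤1+n _))))) c≤) refl
        (subst (λ t → Wins m (config _ i t)) (≡-sym (move-right ls _ (map just w ++ rs)))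
          (scan-right m l i w (just _ ∷ ls) rs _
            (≤-trans (≤-reflexive (≡-sym (+-suc (length ls) _))) c≤) wins))

    scan-left : ∀ m l i w ls rs s → length rs + (length w + suc (length ls)) ≤ bound →
      Wins m (config (run (goL l (end (δL l) s w))) i
                     (atL ls (map just (out (δL l) s w) ʳ++ rs))) →
      Wins m (config (run (goL l s)) i (atL (map just w ++ ls) rs))
    scan-left m l i []      ls rs s c≤ wins = wins
    scan-left m l i (b ∷ w) ls rs s c≤ wins =
      wins-det m (≤-trans (≤-reflexive (trans (+-comm _ (suc (length rs)))
                                         (≡-sym (+-suc (length rs) _))))
          (≤-trans (+-monoʳ-≤ (length rs) (s≤s (≤-trans (≤-reflexive
          (trans (length-++ (map just w)) (cong (_+ length ls) (length-map just w))))
          (+-monoʳ-≤ (length w) (n≤1+n _))))) c≤)) refl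
        (subst (λ t → Wins m (config _ i t)) (≡-sym (move-left (map just w ++ ls) _ rs))
          (scan-left m l i w ls (just _ ∷ rs) _
            (≤-trans (≤-reflexive (≡-sym (+-suc (length rs) _))) c≤) wins))

    -- The work tape stores visited blanks explicitly; `c` and `c′` tell whether the cells bordering
    -- the word on the left and right are among them. Ranging over both hides this detail from the
    -- program.
    At : Mode → L → List B → Fin (suc (suc (length x))) → Set
    At m l w i = ∀ c c′ → Wins m (config (run (goR l on₀)) i (atR (blanks c) (map just w ++ blanks c′)))

    -- In mode `every` rejection is harmless but acceptance must be justified by `Goal`; in mode
    -- `some` acceptance wins outright and rejection loses.
    After : Mode → List B → Fin (suc (suc (length x))) → Outcome L B → Set
    After m w i (outcome e (run l) d) = At m l (cons? e w) (moveInput d i)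
    After m w i (outcome e accept d)  = m ≡ every → Goal
    After m w i (outcome e reject d)  = m ≡ every

    map-just-reverse : ∀ (w : List B) rs → map just w ʳ++ rs ≡ map just (reverse w) ++ rs
    map-just-reverse w rs = trans (ʳ++-defn (map just w)) (cong (_++ rs) (≡-sym (reverse-map just w)))

    module _ (m : Mode) (i : Fin (suc (suc (length x)))) where

      wins-accept : ∀ i′ t → cells t ≤ bound → (m ≡ every → Goal) → Wins m (config accept i′ t)
      wins-accept = go m
        where
        go : ∀ m i′ t → cells t ≤ bound → (m ≡ every → Goal) → Wins m (config accept i′ t)
        go every i′ t c≤ goal = safe c≤ (λ _ → goal refl) λ ()
        go some  i′ t c≤ goal = _ , ε , refl

      wins-reject : ∀ i′ t → cells t ≤ bound → m ≡ every → Wins m (config reject i′ t)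
      wins-reject i′ t c≤ refl = safe c≤ (λ ()) λ ()

      wins-outcome : ∀ w c o → length w + 3 ≤ bound → After m w i o →
        Wins m (perform (toAction o) i (tape [] nothing (map just w ++ blanks c)))
      wins-outcome w c (outcome e l d) w≤ after = go e l after
        where
        rs = map just w ++ blanks c
        rs≤ : length rs ≤ suc (length w)
        rs≤ = ≤-trans (≤-reflexive (trans (length-++ (map just w)) (cong (_+ length (blanks c)) (length-map just w))))
                (≤-trans (+-monoʳ-≤ (length w) (length-blanks c)) (≤-reflexive (+-comm (length w) 1)))
        small : ∀ n → n ≤ suc (suc (suc (length w))) → n ≤ bound
        small n n≤ = ≤-trans n≤ (≤-trans (≤-reflexive (+-comm 3 (length w))) w≤)
        cells-R : ∀ rs → length rs ≤ suc (length w) → cells (atR (nothing ∷ []) rs) ≤ bound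
        cells-R []       _  = small 2 (s≤s (s≤s z≤n))
        cells-R (r ∷ rs) r≤ = small _ (s≤s (≤-trans r≤ (n≤1+n _)))
        moved-right : ∀ {st j} → Wins m (config st j (atR (nothing ∷ []) rs)) →
                      Wins m (config st j (moveTape nothing right (tape [] nothing rs)))
        moved-right = subst (λ t → Wins m (config _ _ t)) (≡-sym (move-right [] nothing rs))
        go : ∀ e l → After m w i (outcome e l d) →
             Wins m (perform (toAction (outcome e l d)) i (tape [] nothing rs))
        go nothing  (run l) after = moved-right (after true c)
        go nothing  accept  after = moved-right (wins-accept _ _ (cells-R rs rs≤) after)
        go nothing  reject  after = moved-right (wins-reject _ _ (cells-R rs rs≤) after)
        go (just b) (run l) after = after false c
        go (just b) accept  after = wins-accept _ _ (small _ (s≤s (≤-trans rs≤ (n≤1+n _)))) after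
        go (just b) reject  after = wins-reject _ _ (small _ (s≤s (≤-trans rs≤ (n≤1+n _)))) after

    length-turned : ∀ l w → length (turned l w) ≤ suc (length w)
    length-turned l w with append l
    ... | nothing = ≤-trans (≤-reflexive (length-reverse-out (δR l) on₀ w)) (n≤1+n _)
    ... | just b  = s≤s (≤-reflexive (length-reverse-out (δR l) on₀ w))

    -- The 4 extra cells cover a letter appended in this round, the two bordering blanks and one
    -- cell of slack in the scan bounds. A prepended letter is free, since it replaces a blank.
    round : ∀ m l w i → length w + 4 ≤ bound →
      Branch m (After m (finalWord l w) i) (decide l (finalState l w) (lookup (inputTape x) i)) →
      At m l w i
    round m l w i w≤ branch c c′ =
      scan-right m l i w (blanks c) (blanks c′) on₀ right≤
        (subst (λ t → Wins m (config _ i t)) (≡-sym (right-end _ c′))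
          (wins-det m (turn≤ (map just (out (δR l) on₀ w) ʳ++ blanks c) (≤-reflexive refl)) refl
            (subst (λ ls → Wins m (perform (turn l (rightState l w) (append l)) i (tape ls nothing [])))
              (≡-sym (map-just-reverse (out (δR l) on₀ w) (blanks c))) turning)))
      where
      n = length w
      small : ∀ k → k ≤ suc (suc (suc n)) → k ≤ bound
      small k k≤ = ≤-trans k≤ (≤-trans (n≤1+n _) (≤-trans (≤-reflexive (+-comm 4 n)) w≤))
      right≤ : length (blanks c) + (n + suc (length (blanks c′))) ≤ bound
      right≤ = small _ (≤-trans (+-mono-≤ (length-blanks c) (+-monoʳ-≤ n (s≤s (length-blanks c′))))
                 (s≤s (≤-reflexive (+-comm n 2))))
      turn≤ : ∀ ls → length ls ≤ length (map just (out (δR l) on₀ w) ʳ++ blanks c) →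
              length ls + 1 ≤ bound
      turn≤ ls ls≤ = small _ (≤-trans (≤-reflexive (+-comm _ 1)) (s≤s (≤-trans ls≤
        (≤-trans (≤-reflexive (trans (length-ʳ++ (map just (out (δR l) on₀ w)))
          (cong (_+ length (blanks c)) (trans (length-map just (out (δR l) on₀ w)) (length-out (δR l) on₀ w)))))
          (≤-trans (+-monoʳ-≤ n (length-blanks c)) (≤-trans (≤-reflexive (+-comm n 1)) (n≤1+n _)))))))

      deciding : ∀ c″ → Wins m (config (run (goL l (finalState l w))) i
                   (tape [] nothing (map just (finalWord l w) ++ blanks c″)))
      deciding c″ = wins-step m
        (small _ (s≤s (≤-trans (≤-reflexive (trans (length-++ (map just (finalWord l w)))
           (cong (_+ length (blanks c″)) (length-map just (finalWord l w)))))
           (≤-trans (+-mono-≤ word≤ (length-blanks c″)) (≤-reflexive (+-comm (suc n) 1))))))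
        (choose m branch)
        where
        word≤ : length (finalWord l w) ≤ suc n
        word≤ = ≤-trans (≤-reflexive (length-reverse-out (δL l) (rightState l w) (turned l w))) (length-turned l w)
        word3≤ : length (finalWord l w) + 3 ≤ bound
        word3≤ = ≤-trans (+-monoˡ-≤ 3 word≤) (≤-trans (≤-reflexive (≡-sym (+-suc n 3))) w≤)
        choose : ∀ m {os} → Branch m (After m (finalWord l w) i) os →
          Branch m (λ a → Wins m (perform a i (tape [] nothing (map just (finalWord l w) ++ blanks c″))))
                 (List⁺.map toAction os)
        choose every all a a∈ with ∈-map⁻ toAction a∈
        ... | o , o∈ , refl = wins-outcome every i (finalWord l w) c″ o word3≤ (all o o∈)
        choose some (o , o∈ , after) =
          _ , ∈-map⁺ toAction o∈ , wins-outcome some i (finalWord l w) c″ o word3≤ after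

      returning : ∀ c″ → Wins m (config (run (goL l (rightState l w))) i
                    (atL (map just (turned l w) ++ blanks c) (blanks c″)))
      returning c″ = scan-left m l i (turned l w) (blanks c) (blanks c″) (rightState l w)
        (≤-trans (+-mono-≤ (length-blanks c″) (+-mono-≤ (length-turned l w) (s≤s (length-blanks c))))
          (≤-trans (≤-reflexive (cong (λ k → suc (suc k)) (+-comm n 2))) (≤-trans (≤-reflexive (+-comm 4 n)) w≤)))
        (subst (λ t → Wins m (config _ i t))
          (≡-sym (trans (left-end c _) (cong (tape [] nothing) (map-just-reverse (out (δL l) (rightState l w) (turned l w)) (blanks c″)))))
          (deciding c″))

      turning : Wins m (perform (turn l (rightState l w) (append l)) i
                  (tape (map just (reverse (out (δR l) on₀ w)) ++ blanks c) nothing []))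
      turning with append l | returning
      -- The blank at which the head turns stays behind as a visited cell, unless an appended letter
      -- is written over it.
      ... | nothing | ret = subst (λ t → Wins m (config _ i t)) (≡-sym (move-left _ nothing [])) (ret true)
      ... | just b  | ret = ret false

    safe-halts : ∀ {κ} → Safe κ → Acc (λ κ₁ κ₂ → κ₂ ⟶ κ₁) κ
    safe-halts (safe _ _ next) = acc λ s → safe-halts (next s)

    safe-reach : ∀ {κ κ′} → Safe κ → κ ⟶* κ′ → Safe κ′
    safe-reach s ε = s
    safe-reach (safe _ _ next) (s ◅ ss) = safe-reach (next s) ss

    safe-space : ∀ {κ} → Safe κ → space κ ≤ bound
    safe-space (safe c≤ _ _) = c≤

    safe-accept : ∀ {κ} → Safe κ → Config.state κ ≡ accept → Goal
    safe-accept (safe _ goal _) = goal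

-- The complementing machine

module Complement {Σ : Set} (Σ-finite : Finite Σ) (M : NTM Σ) where
  open NTM M

  private
    branching : ∃[ k ] (∀ p → length (toList (δ (proj₁ p) (proj₁ (proj₂ p)) (proj₂ (proj₂ p)))) ≤ k)
    branching = finite-bounded
      (finite-× Q-finite (finite-× (finite-InputSymbol Σ-finite) Γ-finite)) _

  k-max : ℕ
  k-max = proj₁ branching

  k-max-bound : ∀ q σ γ → length (toList (δ q σ γ)) ≤ k-max
  k-max-bound q σ γ = proj₂ branching (q , σ , γ)

  -- Indices beyond the listed actions count as dead choices, so one range serves all states and
  -- symbols. The successor gives the range a last element `fromℕ k-max`, from which the choices are
  -- run through downwards.
  Choice : Set
  Choice = Fin (suc k-max)

  -- A cell of M's work tape; the scanned cell also carries the state.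
  Cell : Set
  Cell = Γ × Maybe Q

  Bit : Set
  Bit = Fin 2

  Cell×Bit-finite : Finite (Cell × Bit)
  Cell×Bit-finite = finite-× (finite-× Γ-finite (finite-Maybe Q-finite)) (finite-Fin 2)

  radix-1 : ℕ
  radix-1 = proj₁ Cell×Bit-finite

  Digit : Set
  Digit = Fin (suc radix-1)

  -- The digit 0 is not a code, so that no configuration has number 0.
  code : Cell → Bit → Digit
  code c b = suc (Inverse.to (proj₂ Cell×Bit-finite) (c , b))

  -- The tracks hold the simulated work tape of M, the position of the simulated
  -- input head in binary, and seven counters; `origin` marks M's first cell.
  record Letter : Set where
    constructor letter
    field
      origin   : Bool
      cell     : Cell
      bit      : Bit
      counters : Vec Digit 7

  open Letter public

  Letter-finite : Finite Letter
  Letter-finite = finite-↔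
    (mk↔ₛ′ (λ b → origin b , cell b , bit b , counters b)
           (λ t → letter (proj₁ t) (proj₁ (proj₂ t)) (proj₁ (proj₂ (proj₂ t))) (proj₂ (proj₂ (proj₂ t))))
           (λ _ → refl) (λ _ → refl))
    (finite-× (finite-↔ (↔-sym 2↔Bool) (finite-Fin 2))
      (finite-× (finite-× Γ-finite (finite-Maybe Q-finite))
        (finite-× (finite-Fin 2) (finite-Vec 7 (finite-Fin (suc radix-1))))))

  Counter : Set
  Counter = Fin 7

  -- Depth d, the numbers c and c′ of configurations at depths d and d + 1, the
  -- candidate v at depth d + 1, the number n of configurations at depth d found
  -- so far, the candidate u at depth d, and the time t of the simulation.
  pattern #d  = 0F
  pattern #c  = 1F
  pattern #c′ = 2F
  pattern #v  = 3F
  pattern #n  = 4F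
  pattern #u  = 5F
  pattern #t  = 6F

  counter : Counter → Letter → Digit
  counter r b = lookup (counters b) r

  digit : Letter → Digit
  digit b = code (cell b) (bit b)

  set-counter : Counter → Digit → Letter → Letter
  set-counter r i b = record b { counters = counters b [ r ]≔ i }

  set-cell : Cell → Letter → Letter
  set-cell c b = record b { cell = c }

  set-bit : Bit → Letter → Letter
  set-bit i b = record b { bit = i }

  plain-letter origin-letter : Letter
  plain-letter  = letter false (blank , nothing) zero (Vec.replicate 7 zero)
  origin-letter = letter true  (blank , nothing) zero (Vec.replicate 7 zero)

  data Purpose : Set where
    path edge : Purpose

  -- The choice k in a label is the one whose successors are being checked.
  data Label : Set where
    global : Fin 10 → Label
    local  : Fin 10 → Choice → Label
    exec   : Purpose → Choice → Choice → InputSymbol Σ → Label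
    shift  : Purpose → Choice → Move → Move → Label
    walk   : Purpose → Choice → Move → Label

  pattern boot     = global 0F
  pattern restart  = global 1F
  pattern inc-c    = global 2F
  pattern test-c   = global 3F
  pattern start-v  = global 4F
  pattern inc-v    = global 5F
  pattern inc-c′   = global 6F
  pattern next-d   = global 7F
  pattern inc-d    = global 8F
  pattern extend   = global 9F
  pattern start-u k = local 0F k
  pattern inc-u k   = local 1F k
  pattern rewind k  = local 2F k
  pattern start-t k = local 3F k
  pattern test-t k  = local 4F k
  pattern test-u k  = local 5F k
  pattern inc-n k   = local 6F k
  pattern test-v k  = local 7F k
  pattern test-n k  = local 8F k
  pattern inc-t k   = local 9F k

  Label-finite : Finite Label
  Label-finite = finite-↔
    (mk↔ₛ′
      (λ { (global l) → inj₁ l ; (local l k) → inj₂ (inj₁ (l , k))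
         ; (exec p k j σ) → inj₂ (inj₂ (inj₁ (p , k , j , σ)))
         ; (shift p k d e) → inj₂ (inj₂ (inj₂ (inj₁ (p , k , d , e))))
         ; (walk p k d) → inj₂ (inj₂ (inj₂ (inj₂ (p , k , d)))) })
      (λ { (inj₁ l) → global l ; (inj₂ (inj₁ (l , k))) → local l k
         ; (inj₂ (inj₂ (inj₁ (p , k , j , σ)))) → exec p k j σ
         ; (inj₂ (inj₂ (inj₂ (inj₁ (p , k , d , e))))) → shift p k d e
         ; (inj₂ (inj₂ (inj₂ (inj₂ (p , k , d))))) → walk p k d })
      (λ { (inj₁ l) → refl ; (inj₂ (inj₁ (l , k))) → refl
         ; (inj₂ (inj₂ (inj₁ (p , k , j , σ)))) → refl
         ; (inj₂ (inj₂ (inj₂ (inj₁ (p , k , d , e))))) → refl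
         ; (inj₂ (inj₂ (inj₂ (inj₂ (p , k , d))))) → refl })
      (λ { (global l) → refl ; (local l k) → refl ; (exec p k j σ) → refl
         ; (shift p k d e) → refl ; (walk p k d) → refl }))
    (finite-⊎ (finite-Fin 10) (finite-⊎ (finite-× (finite-Fin 10) fK)
      (finite-⊎ (finite-× fP (finite-× fK (finite-× fK (finite-InputSymbol Σ-finite))))
        (finite-⊎ (finite-× fP (finite-× fK (finite-× finite-Move finite-Move)))
          (finite-× fP (finite-× fK finite-Move))))))
    where
    fK = finite-Fin (suc k-max)
    fP : Finite Purpose
    fP = 2 , mk↔ₛ′ (λ { path → 0F ; edge → 1F }) (λ { 0F → path ; 1F → edge })
                   (λ { 0F → refl ; 1F → refl }) (λ { path → refl ; edge → refl })

  Scan : Set → Set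
  Scan A = Status Q → A → Status Q × A

  on-track : {A : Set} → (Letter → A) → (A → Letter → Letter) → Scan A → Scan Letter
  on-track get put f s b = proj₁ (f s (get b)) , put (proj₂ (f s (get b))) b

  update : (Letter → Letter) → Scan Letter
  update f s b = s , f b

  skip : Scan Letter
  skip = update id

  incr : Counter → Scan Letter
  incr r = on-track (counter r) (set-counter r) incδ

  cellδ : Scan Cell → Scan Letter
  cellδ = on-track cell set-cell

  bitδ : Scan Bit → Scan Letter
  bitδ = on-track bit set-bit

  equal : (Letter → Digit) → (Letter → Digit) → Scan Letter
  equal = eqδ Fin._≟_

  performed : Γ → Q → Maybe (Action Q Γ) → Status Q × Cell
  performed γ q nothing                            = dead , γ , just q
  performed γ q (just (action accept d b e))       = accepting , γ , just q
  performed γ q (just (action reject d b e))       = dead , γ , just q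
  performed γ q (just (action (run q′) d b e))     = moved d e , b , just q′

  -- Scans cannot see the input tape; the preceding round reads the symbol in `decide` and passes it
  -- on in the label.
  execδ : Choice → InputSymbol Σ → Scan Cell
  execδ j σ on (γ , just q) = performed γ q (nth (toList (δ q σ γ)) (toℕ j))
  execδ j σ s  c            = s , c

  -- The scan runs in the direction of the head movement, so the state is put down in the very next
  -- cell. A scan that ends in `holding` has carried it out of the block.
  shiftδ : Scan Cell
  shiftδ on          (γ , just q) = holding q , γ , nothing
  shiftδ (holding q) (γ , _)      = off , γ , just q
  shiftδ s           c            = s , c

  initialCell : Bool → Cell
  initialCell o = blank , (if o then just start else nothing)

  scanR scanL : Label → Scan Letter
  scanR restart         = update λ b → record b { counters = Vec.replicate 7 zero }
  scanR inc-c           = incr #c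
  scanR test-c          = equal (counter #c) (const zero)
  scanR start-v         = update (set-counter #c′ zero ∘ set-counter #v zero)
  scanR inc-v           = incr #v
  scanR inc-c′          = incr #c′
  scanR next-d          = update λ b → set-counter #c (counter #c′ b) b
  scanR inc-d           = incr #d
  scanR (start-u k)     = update (set-counter #n zero ∘ set-counter #u zero)
  scanR (inc-u k)       = incr #u
  scanR (start-t k)     = update λ b →
    set-counter #t zero (set-bit zero (set-cell (initialCell (origin b)) b))
  scanR (test-t k)      = equal (counter #t) (counter #d)
  scanR (test-u k)      = equal digit (counter #u)
  scanR (inc-n k)       = incr #n
  scanR (inc-t k)       = incr #t
  scanR (test-v k)      = equal digit (counter #v)
  scanR (test-n k)      = equal (counter #n) (counter #c)
  scanR (exec p k j σ)  = cellδ (execδ j σ)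
  scanR (shift p k d right) = cellδ shiftδ
  scanR (walk p k right)    = bitδ incδ
  scanR (walk p k left)     = bitδ decδ
  scanR _               = skip

  scanL (shift p k d left) = cellδ shiftδ
  scanL _                  = skip

  appended : Label → Maybe Letter
  appended boot   = just origin-letter
  appended extend = just plain-letter
  appended _      = nothing

  goto : Label → Outcome Label Letter
  goto l = outcome nothing (run l) stay

  accepted rejected : Outcome Label Letter
  accepted     = outcome nothing accept stay
  rejected = outcome nothing reject stay

  -- At an end-marker the head of `M` may be told to move and yet stay; turning such a move into
  -- `stay` keeps the binary position in step with the head.
  clip : InputSymbol Σ → Move → Move
  clip ⊢ left  = stay
  clip ⊣ right = stay
  clip _ d     = d

  after-walk : Purpose → Choice → Label
  after-walk path k = inc-t k
  after-walk edge k = test-v k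

  -- After choice 0 every successor has been compared with v. Then v is absent from the next depth,
  -- and `inc-v` is entered without passing through `inc-c′`.
  next-choice : Choice → Label
  next-choice zero    = inc-v
  next-choice (suc k) = start-u (inject₁ k)

  choices : List⁺ Choice
  choices = zero ∷⁺ List.tabulate suc

  decision : Label → Status Q → InputSymbol Σ → List⁺ (Outcome Label Letter)
  decision boot _ _            = goto restart ∷⁺ []
  decision extend _ _          = outcome (just plain-letter) (run restart) stay ∷⁺ []
  decision restart _ _         = goto inc-c ∷⁺ []
  decision inc-c _ _           = goto test-c ∷⁺ []
  decision test-c on _         = accepted ∷⁺ []
  decision test-c _ _          = goto start-v ∷⁺ []
  decision start-v _ _         = goto (start-u (fromℕ k-max)) ∷⁺ []
  decision inc-v on _          = goto next-d ∷⁺ []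
  decision inc-v _ _           = goto (start-u (fromℕ k-max)) ∷⁺ []
  decision inc-c′ _ _          = goto inc-v ∷⁺ []
  decision next-d _ _          = goto inc-d ∷⁺ []
  -- A default: `reach-depth` keeps the depth below the largest counter value, so this carry does
  -- not occur.
  decision inc-d on _          = rejected ∷⁺ []
  decision inc-d _ _           = goto test-c ∷⁺ []
  decision (start-u k) _ _     = goto (inc-u k) ∷⁺ []
  decision (inc-u k) on _      = goto (test-n k) ∷⁺ []
  -- The guess whether u occurs at depth d: pass over it, or try to exhibit a path to it.
  decision (inc-u k) _ _       = goto (inc-u k) ∷⁺ goto (rewind k) ∷ []
  -- The machine's own input head serves as the simulated one, so it has to return to the left
  -- end-marker before a new path starts.
  decision (rewind k) _ ⊢      = goto (start-t k) ∷⁺ []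
  decision (rewind k) _ _      = outcome nothing (run (rewind k)) left ∷⁺ []
  decision (start-t k) _ _     = goto (test-t k) ∷⁺ []
  decision (test-t k) on _     = goto (test-u k) ∷⁺ []
  decision (test-t k) _ σ      = List⁺.map (λ j → goto (exec path k j σ)) choices
  decision (test-u k) on _     = goto (inc-n k) ∷⁺ []
  decision (test-u k) _ _      = rejected ∷⁺ []
  decision (inc-n k) _ σ       = goto (exec edge k k σ) ∷⁺ []
  decision (inc-t k) _ _       = goto (test-t k) ∷⁺ []
  -- Once v has a predecessor the remaining u and k are abandoned; a complete pass is thus
  -- guaranteed only for an absent v.
  decision (test-v k) on _     = goto inc-c′ ∷⁺ []
  decision (test-v k) _ _      = goto (inc-u k) ∷⁺ []
  decision (test-n k) on _     = goto (next-choice k) ∷⁺ []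
  decision (test-n k) _ _      = rejected ∷⁺ []
  decision (exec path k j σ) dead _         = rejected ∷⁺ []
  decision (exec edge k j σ) dead _         = goto (inc-u k) ∷⁺ []
  decision (exec p k j σ) (moved d e) _     = goto (shift p k (clip σ d) e) ∷⁺ []
  -- This covers `accepting`: when `M` is seen to accept, the complementing machine rejects.
  decision (exec p k j σ) _ _               = rejected ∷⁺ []
  decision (shift p k d e) (holding _) _    = goto extend ∷⁺ []
  decision (shift p k d e) _ _              = goto (walk p k d) ∷⁺ []
  decision (walk p k right) on _            = goto extend ∷⁺ []
  decision (walk p k d) _ _                 = outcome nothing (run (after-walk p k)) d ∷⁺ []

  sweeper : Sweeper Σ
  sweeper = record
    { L = Label ; S = Status Q ; B = Letter
    ; L-finite = Label-finite ; S-finite = finite-Status Q-finite ; B-finite = Letter-finite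
    ; first = boot ; on₀ = on ; δR = scanR ; δL = scanL ; append = appended ; decide = decision }

-- Halting computations

module Halting {Σ : Set} (M : NTM Σ) (x : List Σ) where
  open NTM M
  open Computation M x

  data Path : ℕ → Config → Config → Set where
    []  : ∀ {κ} → Path 0 κ κ
    _∷_ : ∀ {n κ κ′ κ″} → κ ⟶ κ′ → Path n κ′ κ″ → Path (suc n) κ κ″

  _▷_ : ∀ {n κ κ′ κ″} → Path n κ κ′ → κ′ ⟶ κ″ → Path (suc n) κ κ″
  []      ▷ s = s ∷ []
  (r ∷ p) ▷ s = r ∷ (p ▷ s)

  path⇒star : ∀ {n κ κ′} → Path n κ κ′ → κ ⟶* κ′
  path⇒star []      = ε
  path⇒star (s ∷ p) = s ◅ path⇒star p

  list-bounded : ∀ {A : Set} {P : A → ℕ → Set} → (∀ {a m n} → m ≤ n → P a m → P a n) →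
                 ∀ as → (∀ {a} → a ∈ˡ as → ∃[ n ] P a n) → ∃[ n ] (∀ {a} → a ∈ˡ as → P a n)
  list-bounded mono []       f = 0 , λ ()
  list-bounded mono (a ∷ as) f with f (here refl) | list-bounded mono as (λ a∈ → f (there a∈))
  ... | m , pa | n , pas = m ⊔ n , λ where
    (here refl) → mono (m≤m⊔n m n) pa
    (there a∈)  → mono (m≤n⊔m m n) (pas a∈)

  -- König's lemma for a well-founded, finitely branching computation tree, by recursion on
  -- accessibility. The bound measures the loop over depths.
  paths-bounded : ∀ κ → Acc (λ κ₁ κ₂ → κ₂ ⟶ κ₁) κ →
                  ∃[ h ] (∀ {n κ′} → Path n κ κ′ → n ≤ h)
  paths-bounded (config accept  i t) _        = 0 , λ { [] → z≤n }
  paths-bounded (config reject  i t) _        = 0 , λ { [] → z≤n }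
  paths-bounded (config (run q) i t) (acc rs)
    with list-bounded {P = λ a h → ∀ {n κ′} → Path n (perform a i t) κ′ → n ≤ h}
           (λ m≤n f p → ≤-trans (f p) m≤n) (toList (δ q (lookup (inputTape x) i) (WorkTape.head t)))
           (λ a∈ → paths-bounded _ (rs (step a∈)))
  ... | h , f = suc h , λ { [] → z≤n ; (step a∈ ∷ p) → s≤s (f a∈ p) }

  acceptable? : ∀ κ → Acc (λ κ₁ κ₂ → κ₂ ⟶ κ₁) κ →
                Dec (∃[ κ′ ] (κ ⟶* κ′ × Config.state κ′ ≡ accept))
  acceptable? (config accept  i t) _ = yes (_ , ε , refl)
  acceptable? (config reject  i t) _ = no λ { (_ , ε , ()) }
  acceptable? (config (run q) i t) (acc rs) = found (any-dec (toList as) λ a∈ → acceptable? _ (rs (step a∈)))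
    where
    as = δ q (lookup (inputTape x) i) (WorkTape.head t)
    Good : Action Q Γ → Set
    Good a = ∃[ κ′ ] (perform a i t ⟶* κ′ × Config.state κ′ ≡ accept)
    any-dec : ∀ {P : Action Q Γ → Set} as → (∀ {a} → a ∈ˡ as → Dec (P a)) →
              Dec (∃[ a ] (a ∈ˡ as × P a))
    any-dec []       P? = no λ { (_ , () , _) }
    any-dec (a ∷ as) P? with P? (here refl) | any-dec as (λ a∈ → P? (there a∈))
    ... | yes p | _                = yes (a , here refl , p)
    ... | no _  | yes (b , b∈ , p) = yes (b , there b∈ , p)
    ... | no ¬p | no ¬q            = no λ { (_ , here refl , p) → ¬p p ; (b , there b∈ , p) → ¬q (b , b∈ , p) }
    found : Dec (∃[ a ] (a ∈ˡ toList as × Good a)) →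
            Dec (∃[ κ′ ] (config (run q) i t ⟶* κ′ × Config.state κ′ ≡ accept))
    found (yes (a , a∈ , κ′ , steps , e)) = yes (κ′ , step a∈ ◅ steps , e)
    found (no ¬a) = no λ where
      (_ , ε , ())
      (κ′ , step a∈ ◅ steps , e) → ¬a (_ , a∈ , κ′ , steps , e)

-- The computation of M restricted to a block of the work tape

module Block {Σ : Set} (Σ-finite : Finite Σ) (M : NTM Σ) (x : List Σ) (r : ℕ) where
  open NTM M
  open Computation M x
  open Halting M x
  open Complement Σ-finite M using (Choice; k-max; k-max-bound)

  Position : Set
  Position = Fin (suc (suc (length x)))

  -- The block extends r cells to either side of the cell where M starts.
  width : ℕ
  width = r + suc r

  record BlockConfig : Set where
    constructor block
    field
      state     : Q
      inputHead : Position
      work      : WorkTape Γ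

  open BlockConfig public

  data Result : Set where
    dies accepts overflows : Result
    continues              : BlockConfig → Result

  shiftTape : Move → WorkTape Γ → Maybe (WorkTape Γ)
  shiftTape left  (tape [] a rs)       = nothing
  shiftTape left  (tape (l ∷ ls) a rs) = just (tape ls l (a ∷ rs))
  shiftTape stay  t                    = just t
  shiftTape right (tape ls a [])       = nothing
  shiftTape right (tape ls a (r ∷ rs)) = just (tape (a ∷ ls) r rs)

  -- The input position is stored in `width` bits.
  walked : Q → Position → WorkTape Γ → Result
  walked q i t with toℕ i <? 2 ^ width
  ... | yes _ = continues (block q i t)
  ... | no _  = overflows

  shifted : Q → Position → Maybe (WorkTape Γ) → Result
  shifted q i nothing  = overflows
  shifted q i (just t) = walked q i t

  result : Position → WorkTape Γ → Maybe (Action Q Γ) → Result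
  result i t nothing                        = dies
  result i t (just (action accept d b e))   = accepts
  result i t (just (action reject d b e))   = dies
  result i t (just (action (run q) d b e))  = shifted q (moveInput d i) (shiftTape e (writeTape b t))

  actions : BlockConfig → List (Action Q Γ)
  actions (block q i t) = toList (δ q (lookup (inputTape x) i) (WorkTape.head t))

  blockStep : Choice → BlockConfig → Result
  blockStep j β = result (inputHead β) (work β) (nth (actions β) (toℕ j))

  initialBlock : BlockConfig
  initialBlock = block start zero (tape (replicate r blank) blank (replicate r blank))

  -- `M` stores only the visited cells, the block stores all of its cells, so the two differ by
  -- blanks at the ends. This padding starts with r blanks on either side and can only shrink, which
  -- the bounds retain.
  data FitsTape : WorkTape Γ → WorkTape Γ → Set where
    fits : ∀ {ls h rs a b} → a ≤ r → b ≤ r →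
           FitsTape (tape ls h rs) (tape (ls ++ replicate a blank) h (rs ++ replicate b blank))

  data Fits : Config → BlockConfig → Set where
    fits : ∀ {q i t u} → FitsTape t u → Fits (config (run q) i t) (block q i u)

  length-padded : ∀ (as : List Γ) a → length (as ++ replicate a blank) ≡ length as + a
  length-padded as a = trans (length-++ as) (cong (length as +_) (length-replicate a))

  private
    remaining : ∀ {n b} → suc (n + b) ≡ r + suc r → b ≤ r → r ≤ n
    remaining {n} {b} eq b≤r = +-cancelʳ-≤ r r n (begin
      r + r   ≡⟨ suc-injective (trans (≡-sym (+-suc r r)) (≡-sym eq)) ⟩
      n + b   ≤⟨ +-monoʳ-≤ n b≤r ⟩
      n + r   ∎)
      where open ≤-Reasoning

  FitsShifted : WorkTape Γ → Maybe (WorkTape Γ) → Set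
  FitsShifted t nothing  = suc (suc r) ≤ cells t
  FitsShifted t (just u) = FitsTape t u

  -- When the head leaves the block, the padding on that side is used up. At most r blanks remain on
  -- the other side, so at least r + 1 of the 2r + 1 cells have been visited, and the move adds one
  -- more.
  fits-shift : ∀ e {t u} → FitsTape t u → cells u ≡ width →
               FitsShifted (moveTape blank e t) (shiftTape e u)
  fits-shift left (fits {[]} {h} {rs} {zero} {b} a≤ b≤) eq =
    s≤s (s≤s (remaining (trans (cong suc (≡-sym (length-padded rs b))) eq) b≤))
  fits-shift left (fits {[]} {a = suc a} a≤ b≤) eq = fits (<⇒≤ a≤) b≤
  fits-shift left (fits {l ∷ ls} a≤ b≤) eq = fits a≤ b≤
  fits-shift stay f eq = f
  fits-shift right (fits {ls} {h} {[]} {a} {zero} a≤ b≤) eq =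
    ≤-trans (s≤s (s≤s (remaining (trans (cong suc (≡-sym (length-padded ls a)))
      (trans (+-comm 1 _) eq)) a≤))) (≤-reflexive (+-comm 1 (suc (length ls))))
  fits-shift right (fits {rs = []} {b = suc b} a≤ b≤) eq = fits a≤ (<⇒≤ b≤)
  fits-shift right (fits {rs = r ∷ rs} a≤ b≤) eq = fits a≤ b≤

  Overflow : Config → Set
  Overflow κ = suc (suc r) ≤ space κ ⊎ 2 ^ width ≤ suc (length x)

  Match : Config → Result → Set
  Match κ dies          = Config.state κ ≡ reject
  Match κ accepts       = Config.state κ ≡ accept
  Match κ overflows     = Overflow κ
  Match κ (continues β) = Fits κ β

  match-shifted : ∀ q i {t} u → FitsShifted t u → Match (config (run q) i t) (shifted q i u)
  match-shifted q i nothing  f = inj₁ f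
  match-shifted q i (just u) f with toℕ i <? 2 ^ width
  ... | yes _ = fits f
  ... | no i≮ = inj₂ (≤-trans (≮⇒≥ i≮) (≤-pred (toℕ<n i)))

  private
    fits-write : ∀ b {t u} → FitsTape t u → FitsTape (writeTape b t) (writeTape b u)
    fits-write b (fits a≤ b≤) = fits a≤ b≤

    cells-write : ∀ b (u : WorkTape Γ) → cells (writeTape b u) ≡ cells u
    cells-write b (tape _ _ _) = refl

    fits-head : ∀ {t u} → FitsTape t u → WorkTape.head t ≡ WorkTape.head u
    fits-head (fits _ _) = refl

  match-step : ∀ i {t u} → FitsTape t u → cells u ≡ width → ∀ a →
               Match (perform a i t) (result i u (just a))
  match-step i f eq (action accept d b e)  = refl
  match-step i f eq (action reject d b e)  = refl
  match-step i {u = u} f eq (action (run q) d b e) =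
    match-shifted q (moveInput d i) _
      (fits-shift e (fits-write b f) (trans (cells-write b u) eq))

  data Reach : ℕ → BlockConfig → Set where
    here  : Reach 0 initialBlock
    there : ∀ {d β β′} → Reach d β → ∀ j → blockStep j β ≡ continues β′ → Reach (suc d) β′

  initial-fits : Fits initial initialBlock
  initial-fits = fits (fits {ls = []} {rs = []} ≤-refl ≤-refl)

  Sound : BlockConfig → Set
  Sound β = cells (work β) ≡ width × toℕ (inputHead β) < 2 ^ width

  sound-shift : ∀ e u {u′} → shiftTape e u ≡ just u′ → cells u′ ≡ cells u
  sound-shift left  (tape (l ∷ ls) a rs) refl = +-suc (length ls) _
  sound-shift stay  u                    refl = refl
  sound-shift right (tape ls a (_ ∷ rs)) refl = ≡-sym (+-suc (length ls) _)

  sound-step : ∀ j β {β′} → Sound β → blockStep j β ≡ continues β′ → Sound β′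
  sound-step j (block q i u) (w , _) eq with nth (actions (block q i u)) (toℕ j)
  ... | just (action (run q′) d b e) with shiftTape e (writeTape b u) in eq′
  ...   | just u′ with toℕ (moveInput d i) <? 2 ^ width
  ...     | yes i< with refl ← eq =
    trans (sound-shift e (writeTape b u) eq′) (trans (cells-write b u) w) , i<

  reach-sound : ∀ {d β} → Reach d β → Sound β
  reach-sound here = cong₂ (λ m n → m + suc n) (length-replicate r) (length-replicate r) , m^n>0 2 width
  reach-sound (there ρ j eq) = sound-step j _ (reach-sound ρ) eq

  -- The result `dies` is excluded because a choice beyond the listed actions corresponds to no step
  -- of `M`.
  match-block : ∀ j {κ β ρ} → Fits κ β → Sound β → blockStep j β ≡ ρ → ρ ≢ dies →
                ∃[ κ′ ] (κ ⟶ κ′ × Match κ′ ρ)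
  match-block j {config (run q) i t} {block q i u} (fits f) (w , _) eq ρ≢
    with nth (actions (block q i u)) (toℕ j) in eq′
  ... | nothing = contradiction (≡-sym eq) ρ≢
  ... | just a  = perform a i t
    , step (nth-∈ (toList (δ q (lookup (inputTape x) i) (WorkTape.head t))) (toℕ j)
        (trans (cong (λ h → nth (toList (δ q (lookup (inputTape x) i) h)) (toℕ j)) (fits-head f)) eq′))
    , subst (Match (perform a i t)) eq (match-step i f w a)

  reach-path : ∀ {d β} → Reach d β → ∃[ κ ] (Path d initial κ × Fits κ β)
  reach-path here = initial , [] , initial-fits
  reach-path (there ρ j eq) with reach-path ρ
  ... | κ , p , f with match-block j f (reach-sound ρ) eq (λ ())
  ...   | κ′ , s , f′ = κ′ , p ▷ s , f′

  match-machine : ∀ {κ κ′ β} → Fits κ β → Sound β → κ ⟶ κ′ → ∃[ j ] Match κ′ (blockStep j β)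
  match-machine (fits {q} {i} {t} {u} f) (w , _) (step {a = a} a∈)
    with ∈-nth a∈
  ... | n , n< , eq = j , subst (λ ρ → Match (perform a i t) (result i u ρ)) (≡-sym eq′) (match-step i f w a)
    where
    n<′ = ≤-trans n< (≤-trans (k-max-bound q (lookup (inputTape x) i) (WorkTape.head t)) (n≤1+n _))
    j : Choice
    j = fromℕ< n<′
    eq′ : nth (actions (block q i u)) (toℕ j) ≡ just a
    eq′ = trans (cong₂ (λ h m → nth (toList (δ q (lookup (inputTape x) i) h)) m)
                  (≡-sym (fits-head f)) (toℕ-fromℕ< n<′)) eq

  continuation : Result → List BlockConfig
  continuation (continues β) = β ∷ []
  continuation _             = []

  -- A finite enumeration of each depth makes reachability decidable, as the counts require.
  level : ℕ → List BlockConfig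
  level zero    = initialBlock ∷ []
  level (suc d) = concatMap (λ β → concatMap (λ j → continuation (blockStep j β)) (allFin (suc k-max))) (level d)

  reach⇒level : ∀ {d β} → Reach d β → β ∈ˡ level d
  reach⇒level here = here refl
  reach⇒level {suc d} (there {β = β} {β′} ρ j eq) =
    ∈-concatMap⁺ (λ β → concatMap (λ j → continuation (blockStep j β)) (allFin (suc k-max)))
      (lose (reach⇒level ρ) (∈-concatMap⁺ (λ j → continuation (blockStep j β))
        (lose (∈-allFin j) (subst (λ ρ → β′ ∈ˡ continuation ρ) (≡-sym eq) (here refl)))))

  level⇒reach : ∀ d {β} → β ∈ˡ level d → Reach d β
  level⇒reach zero    (here refl) = here
  level⇒reach (suc d) β∈
    with find (∈-concatMap⁻ (λ β → concatMap (λ j → continuation (blockStep j β)) (allFin (suc k-max)))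
                 {xs = level d} β∈)
  ... | β , β∈′ , β∈″ with find (∈-concatMap⁻ (λ j → continuation (blockStep j β)) {xs = allFin (suc k-max)} β∈″)
  ...   | j , _ , β∈‴ with blockStep j β in eq
  ...     | continues _ with here refl ← β∈‴ = there (level⇒reach d β∈′) j eq

  reach? : ∀ {P : BlockConfig → Set} → (∀ β → Dec (P β)) → ∀ d → Dec (∃[ β ] (Reach d β × P β))
  reach? P? d with Any.any? P? (level d)
  ... | yes a = let β , β∈ , p = find a in yes (β , level⇒reach d β∈ , p)
  ... | no ¬a = no λ { (β , ρ , p) → ¬a (lose (reach⇒level ρ) p) }

-- Counting a decidable set of positive numbers

module _ {P : ℕ → Set} (P? : ∀ u → Dec (P u)) where

  count : ℕ → ℕ
  count zero = 0
  count (suc u) with P? (suc u)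
  ... | yes _ = suc (count u)
  ... | no  _ = count u

  count-yes : ∀ u → P (suc u) → count (suc u) ≡ suc (count u)
  count-yes u p with P? (suc u)
  ... | yes _ = refl
  ... | no ¬p = contradiction p ¬p

  count-no : ∀ u → ¬ P (suc u) → count (suc u) ≡ count u
  count-no u ¬p with P? (suc u)
  ... | yes p = contradiction p ¬p
  ... | no _  = refl

  count-≤-suc : ∀ u → count u ≤ count (suc u)
  count-≤-suc u with P? (suc u)
  ... | yes _ = n≤1+n _
  ... | no  _ = ≤-refl

  count≤ : ∀ u → count u ≤ u
  count≤ zero = z≤n
  count≤ (suc u) with P? (suc u)
  ... | yes _ = s≤s (count≤ u)
  ... | no  _ = m≤n⇒m≤1+n (count≤ u)

  count-positive : ∀ {u} n → P (suc u) → u < n → 0 < count n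
  count-positive {u} (suc n) p (s≤s u≤n) with m≤n⇒m<n∨m≡n u≤n
  ... | inj₂ refl = subst (0 <_) (≡-sym (count-yes u p)) (s≤s z≤n)
  ... | inj₁ u<n  = ≤-trans (count-positive n p u<n) (count-≤-suc n)

  count-none : ∀ n → (∀ {u} → u < n → ¬ P (suc u)) → count n ≡ 0
  count-none zero    none = refl
  count-none (suc n) none =
    trans (count-no n (none ≤-refl)) (count-none n λ u< → none (m≤n⇒m≤1+n u<))

  count-one : ∀ {a} n → a < n → P (suc a) → (∀ {u} → P (suc u) → u ≡ a) → count n ≡ 1
  count-one {a} (suc n) (s≤s a≤n) p only with m≤n⇒m<n∨m≡n a≤n
  ... | inj₂ refl = trans (count-yes n p) (cong suc (count-none n λ u< q → <⇒≢ u< (only q)))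
  ... | inj₁ a<n  = trans (count-no n λ q → <⇒≢ a<n (≡-sym (only q))) (count-one n a<n p only)

-- Numbering the configurations of the block

module Numbering {Σ : Set} (Σ-finite : Finite Σ) (M : NTM Σ) (x : List Σ) (r : ℕ) where
  open NTM M
  open Complement Σ-finite M using (Choice; Cell; Bit; Digit; code; radix-1; Cell×Bit-finite)
  open Block Σ-finite M x r
  open Halting M x using (Path)
  module Digits = Numeral Q radix-1
  module Bits = Numeral Q 1

  plain : Γ → Cell
  plain γ = γ , nothing

  cellWord : Q → WorkTape Γ → List Cell
  cellWord q (tape ls h rs) = map plain ls ʳ++ ((h , just q) ∷ map plain rs)

  bits : Position → List Bit
  bits i = Bits.numeral width (toℕ i)

  digitWord : BlockConfig → List Digit
  digitWord β = zipWith code (cellWord (state β) (work β)) (bits (inputHead β))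

  number : BlockConfig → ℕ
  number β = Digits.value (digitWord β)

  length-cellWord : ∀ q t → length (cellWord q t) ≡ cells t
  length-cellWord q (tape ls h rs) = trans (length-ʳ++ (map plain ls))
    (cong₂ (λ m n → m + suc n) (length-map plain ls) (length-map plain rs))

  length-digitWord : ∀ β → Sound β → length (digitWord β) ≡ width
  length-digitWord β (w , _) = trans (length-zipWith code (cellWord (state β) (work β)) (bits (inputHead β)))
    (trans (cong₂ _⊓_ (trans (length-cellWord (state β) (work β)) w)
                      (Bits.length-numeral width (toℕ (inputHead β))))
           (⊓-idem width))

  top : ℕ
  top = suc radix-1 ^ width ∸ 1

  suc-top : suc top ≡ suc radix-1 ^ width
  suc-top = m+[n∸m]≡n (m^n>0 (suc radix-1) width)

  number≤top : ∀ β → Sound β → number β ≤ top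
  number≤top β s = ≤-pred (subst (number β <_)
    (trans (cong (suc radix-1 ^_) (length-digitWord β s)) (≡-sym suc-top)) (Digits.value< (digitWord β)))

  -- Already the least significant digit is positive, since `code` never yields 0.
  number-positive : ∀ β → Sound β → 0 < number β
  number-positive β s = go (cellWord (state β) (work β)) (bits (inputHead β))
    (subst (0 <_) (≡-sym (length-digitWord β s)) (≤-trans (s≤s z≤n) (m≤n+m (suc r) r)))
    where
    go : ∀ cs bs → 0 < length (zipWith code cs bs) → 0 < Digits.value (zipWith code cs bs)
    go (c ∷ cs) (b ∷ bs) _ = s≤s z≤n

  -- A left inverse of `cellWord`; the accumulator collects the cells before the head, nearest
  -- first. It gives the injectivity of the numbering.
  decode : List Γ → List Cell → Maybe (Q × WorkTape Γ)
  decode ls []                  = nothing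
  decode ls ((γ , nothing) ∷ w) = decode (γ ∷ ls) w
  decode ls ((γ , just q) ∷ w)  = just (q , tape ls γ (map proj₁ w))

  decode-plain : ∀ ls γs w → decode ls (map plain γs ++ w) ≡ decode (γs ʳ++ ls) w
  decode-plain ls []       w = refl
  decode-plain ls (γ ∷ γs) w = decode-plain (γ ∷ ls) γs w

  decode-cellWord : ∀ q t → decode [] (cellWord q t) ≡ just (q , t)
  decode-cellWord q (tape ls h rs) = begin
    decode [] (map plain ls ʳ++ w)           ≡⟨ cong (decode []) (trans (ʳ++-defn (map plain ls))
                                                  (cong (_++ w) (≡-sym (reverse-map plain ls)))) ⟩
    decode [] (map plain (reverse ls) ++ w)  ≡⟨ decode-plain [] (reverse ls) w ⟩
    decode (reverse (reverse ls)) w          ≡⟨ cong₂ (λ ls rs → just (q , tape ls h rs))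
                                                  (reverse-involutive ls)
                                                  (trans (≡-sym (map-∘ rs)) (map-id rs)) ⟩
    just (q , tape ls h rs)                  ∎
    where
    open ≡-Reasoning
    w = (h , just q) ∷ map plain rs

  code-injective : ∀ {c b c′ b′} → code c b ≡ code c′ b′ → (c , b) ≡ (c′ , b′)
  code-injective eq = to-injective (proj₂ Cell×Bit-finite) (Fin.suc-injective eq)

  zipWith-code-injective : ∀ cs bs cs′ bs′ → length cs ≡ length bs → length cs′ ≡ length bs′ →
    zipWith code cs bs ≡ zipWith code cs′ bs′ → cs ≡ cs′ × bs ≡ bs′
  zipWith-code-injective [] [] [] [] _ _ _ = refl , refl
  zipWith-code-injective [] [] [] (_ ∷ _) _ () _
  zipWith-code-injective [] [] (_ ∷ _) (_ ∷ _) _ _ ()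
  zipWith-code-injective (c ∷ cs) (b ∷ bs) (c′ ∷ cs′) (b′ ∷ bs′) l l′ eq
    with ∷-injective eq
  ... | e , es with refl ← code-injective {c} {b} {c′} {b′} e
               with zipWith-code-injective cs bs cs′ bs′ (suc-injective l) (suc-injective l′) es
  ...   | refl , refl = refl , refl

  number-injective : ∀ β β′ → Sound β → Sound β′ → number β ≡ number β′ → β ≡ β′
  number-injective (block q i t) (block q′ i′ t′) s@(w , i<) s′@(w′ , i′<) eq
    with zipWith-code-injective (cellWord q t) (bits i) (cellWord q′ t′) (bits i′)
           (trans (length-cellWord q t) (trans w (≡-sym (Bits.length-numeral width (toℕ i)))))
           (trans (length-cellWord q′ t′) (trans w′ (≡-sym (Bits.length-numeral width (toℕ i′)))))
           (Digits.value-injective _ _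
             (trans (length-digitWord (block q i t) s) (≡-sym (length-digitWord (block q′ i′ t′) s′))) eq)
  ... | cs , bs
    with refl ← just-injective (trans (≡-sym (decode-cellWord q t))
                  (trans (cong (decode []) cs) (decode-cellWord q′ t′)))
    = cong (λ i → block q i t) (toℕ-injective (Bits.numeral-injective width i< i′< bs))

  HasNumber : ℕ → ℕ → Set
  HasNumber d u = ∃[ β ] (Reach d β × number β ≡ u)

  hasNumber? : ∀ d u → Dec (HasNumber d u)
  hasNumber? d u = reach? (λ β → number β ≟ u) d

  total : ℕ → ℕ
  total d = count (hasNumber? d) top

  reach-counted : ∀ {d β} → Reach d β → 0 < total d
  reach-counted {d} {β} ρ = positive (number β) refl
    (number-positive β (reach-sound ρ)) (number≤top β (reach-sound ρ))
    where
    positive : ∀ u → number β ≡ u → 0 < u → u ≤ top → 0 < total d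
    positive (suc u) eq _ u< = count-positive (hasNumber? d) top (β , ρ , eq) u<

  total-0 : total 0 ≡ 1
  total-0 = one (number initialBlock) refl
    (number-positive initialBlock (reach-sound here)) (number≤top initialBlock (reach-sound here))
    where
    one : ∀ u → number initialBlock ≡ u → 0 < u → u ≤ top → total 0 ≡ 1
    one (suc u) eq _ u< = count-one (hasNumber? 0) top u< (initialBlock , here , eq)
      λ { (_ , here , eq′) → suc-injective (trans (≡-sym eq′) eq) }

  total-nonzero : ∀ d → total d ≢ 0 → ∃[ β ] Reach d β
  total-nonzero d ≢0 with reach? (λ _ → yes tt) d
  ... | yes (β , ρ , _) = β , ρ
  ... | no ¬ρ = contradiction (count-none (hasNumber? d) top λ _ (β , ρ , _) → ¬ρ (β , ρ , tt)) ≢0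

  -- Unlike `Reach`, a segment is built from its front. A guessed path can thus be followed from the
  -- initial configuration, and a path can be cut at any vertex.
  data Segment : ℕ → BlockConfig → BlockConfig → Set where
    []  : ∀ {β} → Segment 0 β β
    _∷_ : ∀ {n β β′ β″} → (∃[ j ] (blockStep j β ≡ continues β′)) → Segment n β′ β″ →
          Segment (suc n) β β″

  reach-segment : ∀ {d β} → Reach d β → Segment d initialBlock β
  reach-segment here           = []
  reach-segment (there ρ j eq) = snoc (reach-segment ρ) (j , eq)
    where
    snoc : ∀ {n β β′ β″} → Segment n β β′ → (∃[ j ] (blockStep j β′ ≡ continues β″)) → Segment (suc n) β β″
    snoc []      s = s ∷ []
    snoc (t ∷ p) s = t ∷ snoc p s

  reach-append : ∀ {d n β β′} → Reach d β → Segment n β β′ → Reach (n + d) β′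
  reach-append ρ []                   = ρ
  reach-append {β′ = β′} ρ (_∷_ {n} (j , eq) p) =
    subst (λ m → Reach m β′) (+-suc n _) (reach-append (there ρ j eq) p)

  vertex : ∀ {n β β′} → Segment n β β′ → ℕ → BlockConfig
  vertex {β = β} p       zero    = β
  -- A default: only indices up to the length of the segment are used.
  vertex {β = β} []      (suc i) = β
  vertex         (s ∷ p) (suc i) = vertex p i

  prefix : ∀ {n β β′} (p : Segment n β β′) {i} → i ≤ n → Segment i β (vertex p i)
  prefix p       z≤n       = []
  prefix (s ∷ p) (s≤s i≤n) = s ∷ prefix p i≤n

  infixOf : ∀ {n β β′} (p : Segment n β β′) {i j} → i ≤ j → j ≤ n →
            Segment (j ∸ i) (vertex p i) (vertex p j)
  infixOf p       z≤n       j≤n       = prefix p j≤n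
  infixOf (s ∷ p) (s≤s i≤j) (s≤s j≤n) = infixOf p i≤j j≤n

  -- Configurations have numbers from 1 to `top`, so a longer segment repeats one
  -- of them and could be pumped, against the bound on the paths of M.
  reach-depth : ∀ {h} → (∀ {n κ} → Path n (Computation.initial M x) κ → n ≤ h) →
                ∀ {d β} → Reach d β → d < top
  reach-depth {h} bounded {d} {β} ρ with d <? top
  ... | yes d< = d<
  ... | no  d≮ = contradiction (≤-trans (pumped-long (suc h)) (bounded (proj₁ (proj₂ (reach-path (pumped (suc h))))))) 1+n≰n
    where
    p = reach-segment ρ
    at : ∀ {i} → i ≤ d → Reach i (vertex p i)
    at {i} i≤ = subst (λ m → Reach m (vertex p i)) (+-identityʳ i) (reach-append here (prefix p i≤))
    at-sound : (i : Fin (suc d)) → Sound (vertex p (toℕ i))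
    at-sound i = reach-sound (at (≤-pred (toℕ<n i)))
    name< : ∀ i → number (vertex p (toℕ i)) ∸ 1 < top
    name< i = <-≤-trans (∸-monoʳ-< (s≤s z≤n) (number-positive (vertex p (toℕ i)) (at-sound i)))
                        (number≤top (vertex p (toℕ i)) (at-sound i))
    name : Fin (suc d) → Fin top
    name i = fromℕ< (name< i)
    toℕ-name : ∀ i → suc (toℕ (name i)) ≡ number (vertex p (toℕ i))
    toℕ-name i = trans (cong suc (toℕ-fromℕ< (name< i)))
      (m+[n∸m]≡n (number-positive (vertex p (toℕ i)) (at-sound i)))
    collision = pigeonhole (≰⇒> d≮) name
    i = toℕ (proj₁ collision)
    j = toℕ (proj₁ (proj₂ collision))
    i<j : i < j
    i<j = proj₁ (proj₂ (proj₂ collision))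
    j≤d : j ≤ d
    j≤d = ≤-pred (toℕ<n (proj₁ (proj₂ collision)))
    i≤d : i ≤ d
    i≤d = ≤-pred (toℕ<n (proj₁ collision))
    same : vertex p j ≡ vertex p i
    same = number-injective (vertex p j) (vertex p i) (reach-sound (at j≤d)) (reach-sound (at i≤d))
      (trans (≡-sym (toℕ-name (proj₁ (proj₂ collision))))
        (trans (cong (λ i → suc (toℕ i)) (≡-sym (proj₂ (proj₂ (proj₂ collision))))) (toℕ-name (proj₁ collision))))
    loop : Segment (j ∸ i) (vertex p i) (vertex p i)
    loop = subst (Segment (j ∸ i) (vertex p i)) same (infixOf p (<⇒≤ i<j) j≤d)
    length-pumped : ℕ → ℕ
    length-pumped zero    = i
    length-pumped (suc m) = (j ∸ i) + length-pumped m
    pumped : ∀ m → Reach (length-pumped m) (vertex p i)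
    pumped zero    = at i≤d
    pumped (suc m) = reach-append (pumped m) loop
    pumped-long : ∀ m → m ≤ length-pumped m
    pumped-long zero    = z≤n
    pumped-long (suc m) = +-mono-≤ (m<n⇒0<n∸m i<j) (pumped-long m)

-- The rounds of the complementing machine

symbol-at : {Σ : Set} (xs : List Σ) (i : Fin (suc (length xs))) →
  let σ = lookup (Vec.map sym (fromList xs) ∷ʳ ⊣) i in
  (σ ≡ ⊣ × next-cell i ≡ i) ⊎ (∃[ a ] (σ ≡ sym a × toℕ (next-cell i) ≡ suc (toℕ i)))
symbol-at []       zero    = inj₁ (refl , refl)
symbol-at (a ∷ xs) zero    = inj₂ (a , refl , refl)
symbol-at (_ ∷ xs) (suc i) with symbol-at xs i
... | inj₁ (e , eq)     = inj₁ (e , cong suc eq)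
... | inj₂ (a , e , eq) = inj₂ (a , e , cong suc eq)

-- The effect of single rounds on the tracks

module Instructions {Σ : Set} (Σ-finite : Finite Σ) (M : NTM Σ) (x : List Σ)
                    (r bound : ℕ) (Goal : Set) (m : Mode)
                    (roomy : Block.width Σ-finite M x r + 4 ≤ bound) where
  open NTM M using (Q; Γ; blank; start; δ)
  open Complement Σ-finite M
  open Block Σ-finite M x r
  open Numbering Σ-finite M x r
  open Sweep sweeper using (rightState; turned; finalState; finalWord; module Rounds)
  open Rounds x bound Goal

  originWord : List Bool
  originWord = replicate r false ʳ++ (true ∷ replicate r false)

  Shape : List Letter → Set
  Shape w = length w ≡ width × map origin w ≡ originWord

  -- Up to `top` a numeral determines its value, so `small` is what turns comparisons of tracks into
  -- comparisons of numbers.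
  record Holds (w : List Letter) (ν : Vec ℕ 7) : Set where
    constructor holds
    field
      shape : Shape w
      value : ∀ k → map (counter k) w ≡ Digits.numeral width (lookup ν k)
      small : ∀ k → lookup ν k ≤ top

  open Holds

  Simulates : List Letter → BlockConfig → Set
  Simulates w β = map cell w ≡ cellWord (state β) (work β) × map bit w ≡ bits (inputHead β)

  -- The simulated configuration and the input head are left arbitrary here, since they matter only
  -- while a path is being followed; `ReadyAt` fixes them.
  Ready : Label → Vec ℕ 7 → Set
  Ready l ν = ∀ w i → Holds w ν → At m l w i

  ReadyAt : Label → Vec ℕ 7 → BlockConfig → Set
  ReadyAt l ν β = ∀ w → Holds w ν → Simulates w β → At m l w (inputHead β)

  Extends : Set
  Extends = ∀ w i → Shape w → At m extend w i

  small-numeral : ∀ {n} → n ≤ top → n < suc radix-1 ^ width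
  small-numeral {n} n≤ = subst (n <_) suc-top (s≤s n≤)

  one : ∀ {R : Outcome Label Letter → Set} o → R o → Branch m R (o ∷⁺ [])
  one o p = go m
    where
    go : ∀ m′ → Branch m′ _ (o ∷⁺ [])
    go every _ (here refl) = p
    go some  = o , here refl , p

  roundR : ∀ l w i → length w ≡ width → scanL l ≡ skip → appended l ≡ nothing →
    Branch m (After m (out (scanR l) on w) i)
           (decision l (end (scanR l) on w) (lookup (inputTape x) i)) →
    At m l w i
  roundR l w i len eL ea branch =
    round m l w i (subst (λ n → n + 4 ≤ bound) (≡-sym len) roomy)
      (subst₂ (λ w′ s → Branch m (After m w′ i) (decision l s (lookup (inputTape x) i)))
        (≡-sym word) (≡-sym st) branch)
    where
    turned≡ : turned l w ≡ reverse (out (scanR l) on w)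
    turned≡ rewrite ea = refl
    st : finalState l w ≡ end (scanR l) on w
    st rewrite eL = end-idle (λ _ → refl) (turned l w)
    word : finalWord l w ≡ out (scanR l) on w
    word rewrite eL | out-idle {δ = skip} {s = rightState l w} (λ _ → refl) (turned l w) | turned≡ =
      reverse-involutive _

  roundR₁ : ∀ l w i s {o} → length w ≡ width → scanL l ≡ skip → appended l ≡ nothing →
    end (scanR l) on w ≡ s → decision l s (lookup (inputTape x) i) ≡ (o ∷⁺ []) →
    After m (out (scanR l) on w) i o → At m l w i
  roundR₁ l w i s {o} len eL ea es eo after = roundR l w i len eL ea
    (subst (Branch m (After m (out (scanR l) on w) i))
      (≡-sym (trans (cong (λ s → decision l s (lookup (inputTape x) i)) es) eo)) (one o after))

  frame : ∀ {w w′ ν} → Holds w ν → length w′ ≡ length w → map origin w′ ≡ map origin w →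
          (∀ k → map (counter k) w′ ≡ map (counter k) w) → Holds w′ ν
  frame (holds (len , org) val sm) len′ org′ val′ =
    holds (trans len′ len , trans org′ org) (λ k → trans (val′ k) (val k)) sm

  map-update : ∀ f w → out (update f) on w ≡ map f w
  map-update f w = out-map (update f) f (λ _ → refl) w

  holds-assign : ∀ {w ν n} k (g : Letter → Digit) → Holds w ν → n ≤ top →
    map g w ≡ Digits.numeral width n →
    Holds (map (λ b → set-counter k (g b) b) w) (ν [ k ]≔ n)
  holds-assign {w} {ν} {n} k g (holds (len , org) val sm) n≤ eq =
    holds (trans (length-map _ w) len , trans (≡-sym (map-∘ w)) org) val′ sm′
    where
    val′ : ∀ k′ → map (counter k′) (map (λ b → set-counter k (g b) b) w)
                ≡ Digits.numeral width (lookup (ν [ k ]≔ n) k′)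
    val′ k′ with k′ Fin.≟ k
    ... | yes refl = trans (≡-sym (map-∘ w)) (trans (map-cong (λ b → lookup∘update k (counters b) (g b)) w)
                       (trans eq (cong (Digits.numeral width) (≡-sym (lookup∘update k ν n)))))
    ... | no k′≢k  = trans (≡-sym (map-∘ w)) (trans (map-cong (λ b → lookup∘update′ k′≢k (counters b) (g b)) w)
                       (trans (val k′) (cong (Digits.numeral width) (≡-sym (lookup∘update′ k′≢k ν n)))))
    sm′ : ∀ k′ → lookup (ν [ k ]≔ n) k′ ≤ top
    sm′ k′ with k′ Fin.≟ k
    ... | yes refl = subst (_≤ top) (≡-sym (lookup∘update k ν n)) n≤
    ... | no k′≢k  = subst (_≤ top) (≡-sym (lookup∘update′ k′≢k ν n)) (sm k′)

  map-const : ∀ {A B : Set} (b : B) (w : List A) → map (const b) w ≡ replicate (length w) b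
  map-const b []      = refl
  map-const b (_ ∷ w) = cong (b ∷_) (map-const b w)

  holds-reset : ∀ {w ν} k → Holds w ν → Holds (map (set-counter k zero) w) (ν [ k ]≔ 0)
  holds-reset {w} k h = holds-assign k (const zero) h z≤n
    (trans (map-const zero w) (cong (λ n → replicate n zero) (proj₁ (shape h))))

  incr-frame : ∀ {A : Set} k (g : Letter → A) → (∀ i b → g (set-counter k i b) ≡ g b) →
               ∀ w → map g (out (incr k) on w) ≡ map g w
  incr-frame k g eq w = out-frame g (λ s b → eq _ b) on w

  incr-track : ∀ k s b → (proj₁ (incr k s b) ≡ proj₁ (incδ {Q} s (counter k b)))
                       × (counter k (proj₂ (incr k s b)) ≡ proj₂ (incδ {Q} s (counter k b)))
  incr-track k s b = refl , lookup∘update k (counters b) _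

  end-incr : ∀ k w → end (incr k) on w ≡ end (incδ {Q}) on (map (counter k) w)
  end-incr k w = end-track {δ = incr k} {δ′ = incδ} (counter k) (incr-track k) on w

  private
    holds-incr-to : ∀ {w ν n} k → Holds w ν → n ≤ top →
      out (incδ {Q}) on (Digits.numeral width (lookup ν k)) ≡ Digits.numeral width n →
      Holds (out (incr k) on w) (ν [ k ]≔ n)
    holds-incr-to {w} {ν} {n} k (holds (len , org) val sm) n≤ eq = holds
      (trans (length-out (incr k) on w) len , trans (incr-frame k origin (λ _ _ → refl) w) org) val′ sm′
      where
      val′ : ∀ k′ → map (counter k′) (out (incr k) on w) ≡ Digits.numeral width (lookup (ν [ k ]≔ n) k′)
      val′ k′ with k′ Fin.≟ k
      ... | yes refl = trans (out-track {δ = incr k} {δ′ = incδ} (counter k) (incr-track k) on w)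
                         (trans (cong (out incδ on) (val k))
                           (trans eq (cong (Digits.numeral width) (≡-sym (lookup∘update k ν n)))))
      ... | no k′≢k  = trans (incr-frame k (counter k′) (λ i b → lookup∘update′ k′≢k (counters b) i) w)
                         (trans (val k′) (cong (Digits.numeral width) (≡-sym (lookup∘update′ k′≢k ν n))))
      sm′ : ∀ k′ → lookup (ν [ k ]≔ n) k′ ≤ top
      sm′ k′ with k′ Fin.≟ k
      ... | yes refl = subst (_≤ top) (≡-sym (lookup∘update k ν n)) n≤
      ... | no k′≢k  = subst (_≤ top) (≡-sym (lookup∘update′ k′≢k ν n)) (sm k′)

  end-incr-< : ∀ {w ν} k → Holds w ν → lookup ν k < top → end (incr k) on w ≡ off
  end-incr-< {w} {ν} k h n< = trans (end-incr k w) (trans (cong (end incδ on) (value h k))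
    (Digits.end-inc-< width (lookup ν k) (small-numeral n<)))

  end-incr-≡ : ∀ {w ν} k → Holds w ν → lookup ν k ≡ top → end (incr k) on w ≡ on
  end-incr-≡ {w} {ν} k h n≡ = trans (end-incr k w) (trans (cong (end incδ on) (value h k))
    (Digits.end-inc-≡ width (lookup ν k) (trans (cong suc n≡) suc-top)))

  holds-incr : ∀ {w ν} k → Holds w ν → lookup ν k < top →
    Holds (out (incr k) on w) (ν [ k ]≔ suc (lookup ν k))
  holds-incr k h n< = holds-incr-to k h n< refl

  -- The increment that ends a loop also resets its counter, all digits having carried.
  holds-overflow : ∀ {w ν} k → Holds w ν → lookup ν k ≡ top → Holds (out (incr k) on w) (ν [ k ]≔ 0)
  holds-overflow {w} {ν} k h n≡ = holds-incr-to k h z≤n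
    (trans (Digits.inc-overflow (Digits.numeral width (lookup ν k))
             (Digits.end-inc-≡ width (lookup ν k) (trans (cong suc n≡) suc-top)))
           (cong (λ l → replicate l zero) (Digits.length-numeral width (lookup ν k))))

  simulates-incr : ∀ {w} β k → Simulates w β → Simulates (out (incr k) on w) β
  simulates-incr {w} β k (c , b) = trans (incr-frame k cell (λ _ _ → refl) w) c
                               , trans (incr-frame k bit (λ _ _ → refl) w) b

  module _ (f g : Letter → Digit) {w : List Letter} {ν : Vec ℕ 7} {a b : ℕ}
           (a≤ : a ≤ top) (b≤ : b ≤ top) (eqf : map f w ≡ Digits.numeral width a)
           (eqg : map g w ≡ Digits.numeral width b) where

    compare-equal : (end (equal f g) on w ≡ on × a ≡ b) ⊎ (end (equal f g) on w ≡ off × a ≢ b)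
    compare-equal with end-eq {Q = Q} Fin._≟_ f g w
    ... | inj₁ (e , eq)  = inj₁ (e , Digits.numeral-injective width (small-numeral a≤) (small-numeral b≤)
                                       (trans (≡-sym eqf) (trans eq eqg)))
    ... | inj₂ (e , neq) = inj₂ (e , λ { refl → neq (trans eqf (≡-sym eqg)) })

  map-digit : ∀ w → map digit w ≡ zipWith code (map cell w) (map bit w)
  map-digit []      = refl
  map-digit (b ∷ w) = cong (digit b ∷_) (map-digit w)

  -- The cell and bit tracks together spell the number of the configuration, so `digit` can be
  -- compared with a counter as if it were one.
  digits-simulated : ∀ {w} β → Sound β → Simulates w β → map digit w ≡ Digits.numeral width (number β)
  digits-simulated {w} β s (c , b) = begin
    map digit w                               ≡⟨ map-digit w ⟩
    zipWith code (map cell w) (map bit w)     ≡⟨ cong₂ (zipWith code) c b ⟩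
    digitWord β                               ≡⟨ Digits.numeral-value (digitWord β) ⟨
    Digits.numeral (length (digitWord β)) (number β)
                                              ≡⟨ cong (λ l → Digits.numeral l (number β)) (length-digitWord β s) ⟩
    Digits.numeral width (number β)           ∎
    where open ≡-Reasoning

  out-equal : ∀ f g w → out (equal f g) on w ≡ w
  out-equal f g w = out-eq {Q = Q} Fin._≟_ f g on w

-- Simulating one action of `M` on the tracks

module Simulation {Σ : Set} (Σ-finite : Finite Σ) (M : NTM Σ) (x : List Σ)
                  (r bound : ℕ) (Goal : Set) (m : Mode)
                  (roomy : Block.width Σ-finite M x r + 4 ≤ bound) where
  open NTM M using (Q; Γ; blank; start; δ)
  open Complement Σ-finite M
  open Block Σ-finite M x r
  open Numbering Σ-finite M x r
  open Sweep sweeper using (rightState; turned; finalState; finalWord; module Rounds)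
  open Rounds x bound Goal
  open Instructions Σ-finite M x r bound Goal m roomy
  open Holds

  symbol : Position → InputSymbol Σ
  symbol i = lookup (inputTape x) i

  -- After clipping, a move to the left or right changes the position by exactly one, as
  -- decrementing and incrementing the bit track require.
  Clipped : Move → Position → Position → Set
  Clipped stay  i i′ = i′ ≡ i
  Clipped left  i i′ = toℕ i ≡ suc (toℕ i′) × Fin.pred i ≡ i′
  Clipped right i i′ = toℕ i′ ≡ suc (toℕ i) × next-cell i ≡ i′

  clipped : ∀ d i → Clipped (clip (symbol i) d) i (moveInput d i)
  clipped left  zero    = refl
  clipped stay  zero    = refl
  clipped right zero    = refl , refl
  clipped d (suc i) with symbol (suc i) | symbol-at x i
  clipped left  (suc i) | _ | inj₁ (refl , eq)     = cong suc (≡-sym (toℕ-inject₁ i)) , refl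
  clipped stay  (suc i) | _ | inj₁ (refl , eq)     = refl
  clipped right (suc i) | _ | inj₁ (refl , eq)     = cong suc eq
  clipped left  (suc i) | _ | inj₂ (_ , refl , eq) = cong suc (≡-sym (toℕ-inject₁ i)) , refl
  clipped stay  (suc i) | _ | inj₂ (_ , refl , eq) = refl
  clipped right (suc i) | _ | inj₂ (_ , refl , eq) = cong suc eq , refl

  -- A guessed path that dies was a wrong guess, and the machine rejects; a choice that dies in the
  -- edge test has no successor to compare, and the count goes on.
  DeathGoal : Purpose → Choice → Vec ℕ 7 → Set
  DeathGoal path k ν = m ≡ every
  DeathGoal edge k ν = Ready (inc-u k) ν

  -- The obligation left after simulating one action. Acceptance by `M` leads to rejection, which
  -- only mode `every` tolerates.
  StepGoal : Purpose → Choice → Vec ℕ 7 → Result → Set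
  StepGoal p    k ν dies          = DeathGoal p k ν
  StepGoal p    k ν accepts       = m ≡ every
  StepGoal p    k ν overflows     = Extends
  StepGoal p    k ν (continues β) = ReadyAt (after-walk p k) ν β

  roundL : ∀ l w i → length w ≡ width → scanR l ≡ skip → appended l ≡ nothing →
    Branch m (After m (reverse (out (scanL l) on (reverse w))) i)
           (decision l (end (scanL l) on (reverse w)) (symbol i)) →
    At m l w i
  roundL l w i len eR ea branch =
    round m l w i (subst (λ n → n + 4 ≤ bound) (≡-sym len) roomy)
      (subst₂ (λ w′ s → Branch m (After m (reverse (out (scanL l) s w′)) i)
                                 (decision l (end (scanL l) s w′) (symbol i)))
        (≡-sym turned≡) (≡-sym right≡) branch)
    where
    right≡ : rightState l w ≡ on
    right≡ rewrite eR = end-idle (λ _ → refl) w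
    turned≡ : turned l w ≡ reverse w
    turned≡ rewrite ea | eR = cong reverse (out-idle (λ _ → refl) w)

  roundL₁ : ∀ l w i s {o} → length w ≡ width → scanR l ≡ skip → appended l ≡ nothing →
    end (scanL l) on (reverse w) ≡ s → decision l s (symbol i) ≡ (o ∷⁺ []) →
    After m (reverse (out (scanL l) on (reverse w))) i o → At m l w i
  roundL₁ l w i s {o} len eR ea es eo after = roundL l w i len eR ea
    (subst (Branch m (After m (reverse (out (scanL l) on (reverse w))) i))
      (≡-sym (trans (cong (λ s → decision l s (symbol i)) es) eo)) (one o after))

  reverse-map-out : ∀ {A : Set} (g : Letter → A) (f : Scan Letter) → (∀ s b → g (proj₂ (f s b)) ≡ g b) →
                    ∀ w → map g (reverse (out f on (reverse w))) ≡ map g w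
  reverse-map-out g f eq w = begin
    map g (reverse (out f on (reverse w)))  ≡⟨ reverse-map g (out f on (reverse w)) ⟩
    reverse (map g (out f on (reverse w)))  ≡⟨ cong reverse (out-frame g eq on (reverse w)) ⟩
    reverse (map g (reverse w))             ≡⟨ cong reverse (reverse-map g w) ⟩
    reverse (reverse (map g w))             ≡⟨ reverse-involutive (map g w) ⟩
    map g w                                 ∎
    where open ≡-Reasoning

  module _ {f : Scan Cell} {s : Status Q} (idle : ∀ γ → f s (plain γ) ≡ (s , plain γ)) where

    end-before : ∀ ls w → end f s (map plain ls ʳ++ w) ≡ end f s w
    end-before []       w = refl
    end-before (l ∷ ls) w = trans (end-before ls (plain l ∷ w))
                                  (cong (λ p → end f (proj₁ p) w) (idle l))

    out-before : ∀ ls w → out f s (map plain ls ʳ++ w) ≡ map plain ls ʳ++ out f s w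
    out-before []       w = refl
    out-before (l ∷ ls) w = trans (out-before ls (plain l ∷ w))
      (cong (map plain ls ʳ++_) (cong (λ p → proj₂ p ∷ out f (proj₁ p) w) (idle l)))

    end-plain : ∀ rs → end f s (map plain rs) ≡ s
    end-plain []       = refl
    end-plain (a ∷ rs) = trans (cong (λ p → end f (proj₁ p) (map plain rs)) (idle a)) (end-plain rs)

    out-plain : ∀ rs → out f s (map plain rs) ≡ map plain rs
    out-plain []       = refl
    out-plain (a ∷ rs) = trans (cong (λ p → proj₂ p ∷ out f (proj₁ p) (map plain rs)) (idle a))
                               (cong (plain a ∷_) (out-plain rs))

  end-cellδ : ∀ f w → end (cellδ f) on w ≡ end f on (map cell w)
  end-cellδ f w = end-track {δ = cellδ f} {δ′ = f} cell (λ _ _ → refl , refl) on w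

  out-cellδ : ∀ f w → map cell (out (cellδ f) on w) ≡ out f on (map cell w)
  out-cellδ f w = out-track {δ = cellδ f} {δ′ = f} cell (λ _ _ → refl , refl) on w

  end-bitδ : ∀ f w → end (bitδ f) on w ≡ end f on (map bit w)
  end-bitδ f w = end-track {δ = bitδ f} {δ′ = f} bit (λ _ _ → refl , refl) on w

  out-bitδ : ∀ f w → map bit (out (bitδ f) on w) ≡ out f on (map bit w)
  out-bitδ f w = out-track {δ = bitδ f} {δ′ = f} bit (λ _ _ → refl , refl) on w

  holds-cellδ : ∀ {w ν} f → Holds w ν → Holds (out (cellδ f) on w) ν
  holds-cellδ {w} f h = frame h (length-out (cellδ f) on w)
    (out-frame origin (λ _ _ → refl) on w) (λ k → out-frame (counter k) (λ _ _ → refl) on w)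

  holds-cellδ-reverse : ∀ {w ν} f → Holds w ν → Holds (reverse (out (cellδ f) on (reverse w))) ν
  holds-cellδ-reverse {w} f h = frame h
    (trans (length-reverse-out (cellδ f) on (reverse w)) (length-reverse w))
    (reverse-map-out origin (cellδ f) (λ _ _ → refl) w)
    (λ k → reverse-map-out (counter k) (cellδ f) (λ _ _ → refl) w)

  holds-bitδ : ∀ {w ν} f → Holds w ν → Holds (out (bitδ f) on w) ν
  holds-bitδ {w} f h = frame h (length-out (bitδ f) on w)
    (out-frame origin (λ _ _ → refl) on w) (λ k → out-frame (counter k) (λ _ _ → refl) on w)

  ready-walk-clipped : ∀ p k d q i i′ t ν → Clipped d i i′ → toℕ i < 2 ^ width →
    StepGoal p k ν (walked q i′ t) →
    ∀ w → Holds w ν → map cell w ≡ cellWord q t → map bit w ≡ bits i → At m (walk p k d) w i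
  ready-walk-clipped p k stay q i .i t ν refl i< goal w h cs bs with toℕ i <? 2 ^ width
  ... | no i≮ = contradiction i< i≮
  ... | yes _ = roundR₁ (walk p k stay) w i _ (proj₁ (shape h)) refl refl refl refl
    (subst (λ w → At m (after-walk p k) w i) (≡-sym (out-idle (λ _ → refl) w)) (goal w h (cs , bs)))
  ready-walk-clipped p k left q i i′ t ν (eq , refl) i< goal w h cs bs with toℕ i′ <? 2 ^ width
  ... | no i≮ = contradiction (≤-trans (s≤s (≤-trans (n≤1+n _) (≤-reflexive (≡-sym eq)))) i<) i≮
  ... | yes _ = roundR₁ (walk p k left) w i _ (proj₁ (shape h)) refl refl refl refl
    (goal (out (bitδ decδ) on w) (holds-bitδ decδ h)
      (trans (out-frame cell (λ _ _ → refl) on w) cs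
      , trans (out-bitδ decδ w) (trans (cong (out decδ on) (trans bs (cong (Bits.numeral width) eq)))
                                      (Bits.dec-inc (Bits.numeral width (toℕ i′))))))
  ready-walk-clipped p k right q i i′ t ν (eq , refl) i< goal w h cs bs with toℕ i′ <? 2 ^ width
  ... | no i≮ = roundR₁ (walk p k right) w i on (proj₁ (shape h)) refl refl overflow refl
    (goal (out (bitδ incδ) on w) i (shape (holds-bitδ incδ h)))
    where
    overflow : end (bitδ incδ) on w ≡ on
    overflow = trans (end-bitδ incδ w) (trans (cong (end incδ on) bs)
      (Bits.end-inc-≡ width (toℕ i) (≤-antisym i< (≤-trans (≮⇒≥ i≮) (≤-reflexive eq)))))
  ... | yes i′< = roundR₁ (walk p k right) w i off (proj₁ (shape h)) refl refl fine refl
    (goal (out (bitδ incδ) on w) (holds-bitδ incδ h)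
        (trans (out-frame cell (λ _ _ → refl) on w) cs
        , trans (out-bitδ incδ w) (trans (cong (out incδ on) bs)
                                        (cong (Bits.numeral width) (≡-sym eq)))))
    where
    fine : end (bitδ incδ) on w ≡ off
    fine = trans (end-bitδ incδ w) (trans (cong (end incδ on) bs)
      (Bits.end-inc-< width (toℕ i) (subst (_< 2 ^ width) eq i′<)))

  ready-walk : ∀ p k d q i t ν → toℕ i < 2 ^ width → StepGoal p k ν (walked q (moveInput d i) t) →
    ∀ w → Holds w ν → map cell w ≡ cellWord q t → map bit w ≡ bits i →
    At m (walk p k (clip (symbol i) d)) w i
  ready-walk p k d q i t ν = ready-walk-clipped p k (clip (symbol i) d) q i (moveInput d i) t ν (clipped d i)

  shift-scan : ∀ q ls h a rs →
    (end shiftδ on (cellWord q (tape ls h (a ∷ rs))) ≡ off)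
    × (out shiftδ on (cellWord q (tape ls h (a ∷ rs))) ≡ cellWord q (tape (h ∷ ls) a rs))
  shift-scan q ls h a rs =
      trans (end-before {f = shiftδ} {s = on} (λ _ → refl) ls _) (end-plain {f = shiftδ} (λ _ → refl) rs)
    , trans (out-before {f = shiftδ} {s = on} (λ _ → refl) ls _)
        (cong (λ w → map plain (h ∷ ls) ʳ++ ((a , just q) ∷ w)) (out-plain {f = shiftδ} (λ _ → refl) rs))

  shift-scan-end : ∀ q ls h → end shiftδ on (cellWord q (tape ls h [])) ≡ holding q
  shift-scan-end q ls h = end-before {f = shiftδ} {s = on} (λ _ → refl) ls _

  -- Mirror symmetry of the encoding: a shift to the left is a shift to the right on the reversed
  -- word, so `shift-scan` serves both directions.
  reverse-cellWord : ∀ q ls h rs → reverse (cellWord q (tape ls h rs)) ≡ cellWord q (tape rs h ls)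
  reverse-cellWord q ls h rs =
    trans (ʳ++-ʳ++ (map plain ls))
          (cong (λ w → map plain rs ʳ++ ((h , just q) ∷ w)) (++-identityʳ (map plain ls)))

  ready-shift : ∀ p k d e q i t ν → toℕ i < 2 ^ width →
    StepGoal p k ν (shifted q (moveInput d i) (shiftTape e t)) →
    ∀ w → Holds w ν → map cell w ≡ cellWord q t → map bit w ≡ bits i →
    At m (shift p k (clip (symbol i) d) e) w i
  ready-shift p k d stay q i t ν i< goal w h cs bs =
    roundR₁ (shift p k _ stay) w i on (proj₁ (shape h)) refl refl (end-idle (λ _ → refl) w) refl
      (subst (λ w → At m (walk p k (clip (symbol i) d)) w i) (≡-sym (out-idle (λ _ → refl) w))
        (ready-walk p k d q i t ν i< goal w h cs bs))
  ready-shift p k d right q i (tape ls a []) ν i< goal w h cs bs =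
    roundR₁ (shift p k _ right) w i _ (proj₁ (shape h)) refl refl
      (trans (end-cellδ shiftδ w) (trans (cong (end shiftδ on) cs) (shift-scan-end q ls a))) refl
        (goal _ i (shape (holds-cellδ shiftδ h)))
  ready-shift p k d right q i (tape ls a (b ∷ rs)) ν i< goal w h cs bs =
    roundR₁ (shift p k _ right) w i _ (proj₁ (shape h)) refl refl
      (trans (end-cellδ shiftδ w) (trans (cong (end shiftδ on) cs) (proj₁ scan))) refl
        (ready-walk p k d q i (tape (a ∷ ls) b rs) ν i< goal _ (holds-cellδ shiftδ h)
          (trans (out-cellδ shiftδ w) (trans (cong (out shiftδ on) cs) (proj₂ scan)))
          (trans (out-frame bit (λ _ _ → refl) on w) bs))
    where scan = shift-scan q ls a b rs
  ready-shift p k d left q i (tape [] a rs) ν i< goal w h cs bs =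
    roundL₁ (shift p k _ left) w i _ (proj₁ (shape h)) refl refl
      (trans (end-cellδ shiftδ (reverse w)) (trans (cong (end shiftδ on)
          (trans (reverse-map cell w) (trans (cong reverse cs) (reverse-cellWord q [] a rs))))
          (shift-scan-end q rs a))) refl
        (goal _ i (shape (holds-cellδ-reverse shiftδ h)))
  ready-shift p k d left q i (tape (b ∷ ls) a rs) ν i< goal w h cs bs =
    roundL₁ (shift p k _ left) w i _ (proj₁ (shape h)) refl refl
      (trans (end-cellδ shiftδ (reverse w)) (trans (cong (end shiftδ on) mirrored) (proj₁ scan))) refl
        (ready-walk p k d q i (tape ls b (a ∷ rs)) ν i< goal _ (holds-cellδ-reverse shiftδ h)
          (trans (reverse-map cell (out (cellδ shiftδ) on (reverse w)))
            (trans (cong reverse (trans (out-cellδ shiftδ (reverse w))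
                     (trans (cong (out shiftδ on) mirrored) (proj₂ scan))))
              (reverse-cellWord q (a ∷ rs) b ls)))
          (trans (reverse-map-out bit (cellδ shiftδ) (λ _ _ → refl) w) bs))
    where
    scan = shift-scan q rs a b ls
    mirrored : map cell (reverse w) ≡ cellWord q (tape rs a (b ∷ ls))
    mirrored = trans (reverse-map cell w) (trans (cong reverse cs) (reverse-cellWord q (b ∷ ls) a rs))

  execδ-idle : ∀ j σ {s} → s ≢ on → ∀ c → execδ j σ s c ≡ (s , c)
  execδ-idle j σ {on}        ≢on c = contradiction refl ≢on
  execδ-idle j σ {off}       _   c = refl
  execδ-idle j σ {dead}      _   c = refl
  execδ-idle j σ {accepting} _   c = refl
  execδ-idle j σ {moved _ _} _   c = refl
  execδ-idle j σ {holding _} _   c = refl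

  performed-≢on : ∀ γ q a → proj₁ (performed γ q a) ≢ on
  performed-≢on γ q nothing                         ()
  performed-≢on γ q (just (action accept _ _ _))    ()
  performed-≢on γ q (just (action reject _ _ _))    ()
  performed-≢on γ q (just (action (run _) _ _ _))   ()

  exec-scan : ∀ j σ q ls h rs {a} → nth (toList (δ q σ h)) (toℕ j) ≡ a →
    (end (execδ j σ) on (cellWord q (tape ls h rs)) ≡ proj₁ (performed h q a))
    × (out (execδ j σ) on (cellWord q (tape ls h rs)) ≡
       map plain ls ʳ++ (proj₂ (performed h q a) ∷ map plain rs))
  exec-scan j σ q ls h rs refl =
      trans (end-before {f = execδ j σ} {s = on} (λ _ → refl) ls _) (end-plain {f = execδ j σ} (λ γ → idle (plain γ)) rs)
    , trans (out-before {f = execδ j σ} {s = on} (λ _ → refl) ls _)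
        (cong (λ w → map plain ls ʳ++ (_ ∷ w)) (out-plain {f = execδ j σ} (λ γ → idle (plain γ)) rs))
    where idle = execδ-idle j σ (performed-≢on h q (nth (toList (δ q σ h)) (toℕ j)))

  ready-exec : ∀ p k j ν β → Sound β → StepGoal p k ν (blockStep j β) →
    ReadyAt (exec p k j (symbol (inputHead β))) ν β
  ready-exec p k j ν (block q i t@(tape ls h rs)) (_ , i<) goal w hw (cs , bs)
    with nth (toList (δ q (symbol i) h)) (toℕ j) in eq
  ... | a = roundR (exec p k j (symbol i)) w i (proj₁ (shape hw)) refl refl
    (subst (λ s → Branch m (After m w′ i) (decision (exec p k j (symbol i)) s (symbol i)))
      (≡-sym (trans (end-cellδ (execδ j (symbol i)) w)
        (trans (cong (end (execδ j (symbol i)) on) cs) (proj₁ scan))))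
      (branch p a goal word))
    where
    scan = exec-scan j (symbol i) q ls h rs eq
    w′ = out (cellδ (execδ j (symbol i))) on w
    word : map cell w′ ≡ map plain ls ʳ++ (proj₂ (performed h q a) ∷ map plain rs)
    word = trans (out-cellδ (execδ j (symbol i)) w) (trans (cong (out (execδ j (symbol i)) on) cs) (proj₂ scan))
    h′ = holds-cellδ (execδ j (symbol i)) hw
    branch : ∀ p a → StepGoal p k ν (result i t a) →
      map cell w′ ≡ map plain ls ʳ++ (proj₂ (performed h q a) ∷ map plain rs) →
      Branch m (After m w′ i) (decision (exec p k j (symbol i)) (proj₁ (performed h q a)) (symbol i))
    branch path nothing                       goal _ = one _ goal
    branch edge nothing                       goal _ = one _ (goal w′ i h′)
    branch path (just (action reject _ _ _))  goal _ = one _ goal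
    branch edge (just (action reject _ _ _))  goal _ = one _ (goal w′ i h′)
    branch path (just (action accept _ _ _))  goal _ = one _ goal
    branch edge (just (action accept _ _ _))  goal _ = one _ goal
    branch path (just (action (run q′) d b e)) goal cs′ = one _
      (ready-shift path k d e q′ i (writeTape b t) ν i< goal w′ h′ cs′ (trans (out-frame bit (λ _ _ → refl) on w) bs))
    branch edge (just (action (run q′) d b e)) goal cs′ = one _
      (ready-shift edge k d e q′ i (writeTape b t) ν i< goal w′ h′ cs′ (trans (out-frame bit (λ _ _ → refl) on w) bs))

-- Inductive counting

module Loops {Σ : Set} (Σ-finite : Finite Σ) (M : NTM Σ) (x : List Σ)
             (r bound : ℕ) (Goal : Set) (m : Mode)
             (roomy : Block.width Σ-finite M x r + 4 ≤ bound) where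
  open NTM M using (Q; Γ; blank; start; δ)
  open Complement Σ-finite M
  open Block Σ-finite M x r
  open Numbering Σ-finite M x r
  open Halting M x using (Path)
  open Sweep sweeper using (module Rounds)
  open Rounds x bound Goal
  open Instructions Σ-finite M x r bound Goal m roomy
  open Simulation Σ-finite M x r bound Goal m roomy
  open Holds

  regs : (d c c′ v n u t : ℕ) → Vec ℕ 7
  regs d c c′ v n u t = d Vec.∷ c Vec.∷ c′ Vec.∷ v Vec.∷ n Vec.∷ u Vec.∷ t Vec.∷ Vec.[]

  mode? : m ≡ every ⊎ m ≡ some
  mode? = go m
    where
    go : ∀ m → m ≡ every ⊎ m ≡ some
    go every = inj₁ refl
    go some  = inj₂ refl

  branch-every : ∀ {R : Outcome Label Letter → Set} {os} → m ≡ every →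
                 (∀ o → o ∈ˡ toList os → R o) → Branch m R os
  branch-every refl all = all

  branch-some : ∀ {R : Outcome Label Letter → Set} {os} → m ≡ some →
                ∀ o → o ∈ˡ toList os → R o → Branch m R os
  branch-some refl o o∈ p = o , o∈ , p

  incr-then : ∀ l l′ k {ν} → scanR l ≡ incr k → scanL l ≡ skip → appended l ≡ nothing →
    (∀ σ → decision l off σ ≡ (goto l′ ∷⁺ [])) → lookup ν k < top →
    Ready l′ (ν [ k ]≔ suc (lookup ν k)) → Ready l ν
  incr-then l l′ k eR eL ea eo n< ready w i h = roundR₁ l w i off (proj₁ (shape h)) eL ea
    (trans (cong (λ f → end f on w) eR) (end-incr-< k h n<)) (eo _)
    (subst (λ f → At m l′ (out f on w) i) (≡-sym eR) (ready _ i (holds-incr k h n<)))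

  overflow-then : ∀ l l′ k {ν} → scanR l ≡ incr k → scanL l ≡ skip → appended l ≡ nothing →
    (∀ σ → decision l on σ ≡ (goto l′ ∷⁺ [])) → lookup ν k ≡ top →
    Ready l′ (ν [ k ]≔ 0) → Ready l ν
  overflow-then l l′ k eR eL ea eo n≡ ready w i h = roundR₁ l w i on (proj₁ (shape h)) eL ea
    (trans (cong (λ f → end f on w) eR) (end-incr-≡ k h n≡)) (eo _)
    (subst (λ f → At m l′ (out f on w) i) (≡-sym eR) (ready _ i (holds-overflow k h n≡)))

  update-then : ∀ l l′ f {ν ν′} → scanR l ≡ update f → scanL l ≡ skip → appended l ≡ nothing →
    (∀ s σ → decision l s σ ≡ (goto l′ ∷⁺ [])) → (∀ {w} → Holds w ν → Holds (map f w) ν′) →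
    Ready l′ ν′ → Ready l ν
  update-then l l′ f eR eL ea eo h⇒h′ ready w i h = roundR₁ l w i _ (proj₁ (shape h)) eL ea refl (eo _ _)
    (subst (λ w′ → At m l′ w′ i)
      (≡-sym (trans (cong (λ f → out f on w) eR) (map-update f w))) (ready _ i (h⇒h′ h)))

  test : ∀ l (f g : Letter → Digit) {w i ν a b} → Holds w ν →
    scanR l ≡ equal f g → scanL l ≡ skip → appended l ≡ nothing →
    a ≤ top → b ≤ top → map f w ≡ Digits.numeral width a → map g w ≡ Digits.numeral width b →
    (a ≡ b → Branch m (After m w i) (decision l on (symbol i))) →
    (a ≢ b → Branch m (After m w i) (decision l off (symbol i))) →
    At m l w i
  test l f g {w} {i} {ν} h eR eL ea a≤ b≤ eqf eqg same differ =
    roundR l w i (proj₁ (shape h)) eL ea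
      (subst (λ s → Branch m (After m (out s on w) i) (decision l (end s on w) (symbol i))) (≡-sym eR)
        (subst (λ w′ → Branch m (After m w′ i) (decision l (end (equal f g) on w) (symbol i)))
          (≡-sym (out-equal f g w)) compared))
    where
    compared : Branch m (After m w i) (decision l (end (equal f g) on w) (symbol i))
    compared with compare-equal f g {w} {ν} a≤ b≤ eqf eqg
    ... | inj₁ (e , eq)  = subst (λ s → Branch m (After m w i) (decision l s (symbol i))) (≡-sym e) (same eq)
    ... | inj₂ (e , neq) = subst (λ s → Branch m (After m w i) (decision l s (symbol i))) (≡-sym e) (differ neq)

  ready-rewind : ∀ k {ν} → (∀ w → Holds w ν → At m (start-t k) w zero) → Ready (rewind k) ν
  ready-rewind k {ν} ready w i h = go (toℕ i) i refl w h
    where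
    stays : ∀ w → out skip on w ≡ w
    stays = out-idle (λ _ → refl)
    go : ∀ n i → toℕ i ≡ n → ∀ w → Holds w ν → At m (rewind k) w i
    go n zero _ w h = roundR₁ (rewind k) w zero _ (proj₁ (shape h)) refl refl refl refl
      (subst (λ w′ → At m (start-t k) w′ zero) (≡-sym (stays w)) (ready w h))
    go (suc n) (suc i) eq w h = roundR (rewind k) w (suc i) (proj₁ (shape h)) refl refl (back (symbol-at x i))
      where
      back : _ → Branch m (After m (out skip on w) (suc i)) (decision (rewind k) (end skip on w) (symbol (suc i)))
      back s with symbol (suc i) | s
      ... | _ | inj₁ (refl , _)     = one _ (subst (λ w′ → At m (rewind k) w′ (inject₁ i)) (≡-sym (stays w))
                                        (go n (inject₁ i) (trans (toℕ-inject₁ i) (suc-injective eq)) w h))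
      ... | _ | inj₂ (_ , refl , _) = one _ (subst (λ w′ → At m (rewind k) w′ (inject₁ i)) (≡-sym (stays w))
                                        (go n (inject₁ i) (trans (toℕ-inject₁ i) (suc-injective eq)) w h))

  -- These are the results after which the count may go on: acceptance leads to rejection and
  -- overflow to a restart.
  data Clean (k : Choice) (β : BlockConfig) : Set where
    dead-end  : blockStep k β ≡ dies → Clean k β
    continued : ∀ {β′} → blockStep k β ≡ continues β′ → Clean k β

  AllClean : ℕ → Set
  AllClean d = ∀ {β} → Reach d β → ∀ k → Clean k β

  module _ (extends : ∀ {d β} j → Reach d β → blockStep j β ≡ overflows → Extends)
           (unaccepted : ∀ {d β} j → Reach d β → blockStep j β ≡ accepts → m ≡ every) where

    module Level (d : ℕ) (d<top : d < top) where

      c : ℕ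
      c = total d

      Avoids : ℕ → Choice → BlockConfig → Set
      Avoids v k β = Clean k β × (∀ {β′} → blockStep k β ≡ continues β′ → number β′ ≢ v)

      -- The obligation at the early exit, taken when v turns out to have a predecessor.
      found? : ℕ → ℕ → Set
      found? c′ v = ∀ {n u t} → HasNumber (suc d) v → Ready inc-c′ (regs d c c′ v n u t)

      module Target (c′ v : ℕ) (c′≤ : c′ ≤ top) (v≤ : v ≤ top) (found : found? c′ v) where

        σν : (n u t : ℕ) → Vec ℕ 7
        σν n u t = regs d c c′ v n u t

        ready-path : ∀ k u rem t {n} β → t + rem ≡ d → Reach t β →
          (m ≡ every ⊎ (m ≡ some × ∃[ β′ ] (Segment rem β β′ × number β′ ≡ u))) →
          (∀ β → Reach d β → number β ≡ u → ReadyAt (inc-n k) (σν n u d) β) →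
          ReadyAt (test-t k) (σν n u t) β
        ready-path k u zero t {n} β eq ρ want ready w h sim
          with refl ← trans (≡-sym (+-identityʳ t)) eq =
          test (test-t k) (counter #t) (counter #d) h refl refl refl (small h #t) (small h #d) (value h #t) (value h #d)
            (λ _ → one _ at-end) (λ neq → contradiction refl neq)
          where
          reject-ok : (m ≡ every ⊎ (m ≡ some × ∃[ β′ ] (Segment 0 β β′ × number β′ ≡ u))) →
                      number β ≢ u → m ≡ every
          reject-ok (inj₁ e)                      _   = e
          reject-ok (inj₂ (_ , _ , [] , number≡)) neq = contradiction number≡ neq
          at-end : At m (test-u k) w (inputHead β)
          at-end = test (test-u k) digit (counter #u) h refl refl refl
            (number≤top β (reach-sound ρ)) (small h #u) (digits-simulated β (reach-sound ρ) sim) (value h #u)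
            (λ e → one _ (ready β ρ e w h sim)) (λ neq → one _ (reject-ok want neq))
        ready-path k u (suc rem) t {n} β eq ρ want ready w h sim =
          test (test-t k) (counter #t) (counter #d) h refl refl refl (small h #t) (small h #d) (value h #t) (value h #d)
            (λ e → contradiction (≤-reflexive (≡-sym (trans e (≡-sym eq)))) (<⇒≱ (m<m+n t (s≤s z≤n))))
            (λ _ → choose want)
          where
          continue : ∀ j {β′} → blockStep j β ≡ continues β′ →
            (m ≡ every ⊎ (m ≡ some × ∃[ β″ ] (Segment rem β′ β″ × number β″ ≡ u))) →
            ReadyAt (inc-t k) (σν n u t) β′
          continue j {β′} step want′ w h sim = roundR₁ (inc-t k) w (inputHead β′) off (proj₁ (shape h)) refl refl
            (end-incr-< #t h t<) refl
            (ready-path k u rem (suc t) β′ (trans (≡-sym (+-suc t rem)) eq) (there ρ j step) want′ ready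
              (out (incr #t) on w) (holds-incr #t h t<) (simulates-incr β′ #t sim))
            where t< = <-trans (subst (t <_) eq (m<m+n t (s≤s z≤n))) d<top
          goal : m ≡ every → ∀ j ρ → blockStep j β ≡ ρ → StepGoal path k (σν n u t) ρ
          goal e j dies          _  = e
          goal e j accepts       _  = e
          goal e j overflows     eq = extends j ρ eq
          goal e j (continues _) eq = continue j eq (inj₁ e)
          choose : _ → Branch m (After m w (inputHead β)) (decision (test-t k) off (symbol (inputHead β)))
          choose (inj₁ e) = branch-every e λ o o∈ → all o o∈
            where
            all : ∀ o → o ∈ˡ toList (decision (test-t k) off (symbol (inputHead β))) → After m w (inputHead β) o
            all o o∈ with ∈-map⁻ (λ j → goto (exec path k j (symbol (inputHead β)))) {xs = toList choices} o∈
            ... | j , _ , refl = ready-exec path k j (σν n u t) β (reach-sound ρ) (goal e j _ refl) w h sim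
          choose (inj₂ (e , β″ , (j , step) ∷ seg , number≡)) =
            branch-some e _ (∈-map⁺ (λ j → goto (exec path k j (symbol (inputHead β)))) {xs = toList choices} (chosen j))
              (ready-exec path k j (σν n u t) β (reach-sound ρ)
                (subst (StepGoal path k (σν n u t)) (≡-sym step) (continue j step (inj₂ (e , β″ , seg , number≡)))) w h sim)
            where
            chosen : ∀ j → j ∈ˡ toList choices
            chosen zero    = here refl
            chosen (suc j) = there (∈-tabulate⁺ {f = suc} j)

        -- The count resumes only with evidence that `β` does not lead to v by choice k; an edge to
        -- v leaves through `found`.
        ready-inc-n : ∀ k {n u t} β → Reach d β → n < top →
          (Avoids v k β → Ready (inc-u k) (σν (suc n) u t)) → ReadyAt (inc-n k) (σν n u t) β
        ready-inc-n k {n} {u} {t} β ρ n< ready w h sim =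
          roundR₁ (inc-n k) w (inputHead β) off (proj₁ (shape h)) refl refl (end-incr-< #n h n<) refl
            (ready-exec edge k k (σν (suc n) u t) β (reach-sound ρ) (goal _ refl)
              (out (incr #n) on w) (holds-incr #n h n<) (simulates-incr β #n sim))
          where
          goal : ∀ ρ′ → blockStep k β ≡ ρ′ → StepGoal edge k (σν (suc n) u t) ρ′
          goal dies           eq = ready (dead-end eq , λ eq′ → contradiction (trans (≡-sym eq) eq′) λ ())
          goal accepts        eq = unaccepted k ρ eq
          goal overflows      eq = extends k ρ eq
          goal (continues β′) eq w h sim =
            test (test-v k) digit (counter #v) h refl refl refl
              (number≤top β′ (reach-sound ρ′)) (small h #v) (digits-simulated β′ (reach-sound ρ′) sim) (value h #v)
              (λ e → one _ (found (β′ , ρ′ , e) w (inputHead β′) h))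
              (λ neq → one _ (ready (continued eq , λ eq′ → same neq (trans (≡-sym eq) eq′)) w (inputHead β′) h))
            where
            ρ′ : Reach (suc d) β′
            ρ′ = there ρ k eq
            same : number β′ ≢ v → ∀ {β″} → continues β′ ≡ continues β″ → number β″ ≢ v
            same neq refl = neq

        counted : ℕ → ℕ
        counted = count (hasNumber? d)

        -- Either a configuration has been missed, or all have been checked.
        Tally : Choice → ℕ → ℕ → Set
        Tally k u n = (m ≡ every × n < counted u)
                    ⊎ (n ≡ counted u × (∀ {β} → Reach d β → number β ≤ u → Avoids v k β))

        tally≤ : ∀ {k} u {n} → Tally k u n → n ≤ u
        tally≤ u (inj₁ (_ , n<)) = ≤-trans (<⇒≤ n<) (count≤ (hasNumber? d) u)
        tally≤ u (inj₂ (eq , _)) = ≤-trans (≤-reflexive eq) (count≤ (hasNumber? d) u)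

        -- The soundness of counting: a configuration that is passed over leaves n behind the true
        -- count for the rest of the pass.
        tally-miss : ∀ {k u n} → m ≡ every → Tally k u n → HasNumber d (suc u) → Tally k (suc u) n
        tally-miss {u = u} e tally has = inj₁ (e , <-≤-trans (s≤s (n≤ tally)) (≤-reflexive (≡-sym (count-yes (hasNumber? d) u has))))
          where
          n≤ : Tally _ u _ → _ ≤ counted u
          n≤ (inj₁ (_ , n<)) = <⇒≤ n<
          n≤ (inj₂ (eq , _)) = ≤-reflexive eq

        tally-skip : ∀ {k u n} → Tally k u n → ¬ HasNumber d (suc u) → Tally k (suc u) n
        tally-skip {u = u} tally ¬has rewrite count-no (hasNumber? d) u ¬has with tally
        ... | inj₁ lt         = inj₁ lt
        ... | inj₂ (eq , all) = inj₂ (eq , λ {β} ρ le → all ρ (lower ρ le))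
          where
          lower : ∀ {β} → Reach d β → number β ≤ suc u → number β ≤ u
          lower {β} ρ le with m≤n⇒m<n∨m≡n le
          ... | inj₁ lt = ≤-pred lt
          ... | inj₂ eq = contradiction (β , ρ , eq) ¬has

        -- Numbers determine configurations, so the end of the guessed path is the only
        -- configuration that has to be checked for this number.
        tally-hit : ∀ {k u n β} → Tally k u n → Reach d β → number β ≡ suc u → Avoids v k β →
                    Tally k (suc u) (suc n)
        tally-hit {k} {u} {n} {β} tally ρ number≡ avoids
          rewrite count-yes (hasNumber? d) u (β , ρ , number≡) with tally
        ... | inj₁ (e , lt)   = inj₁ (e , s≤s lt)
        ... | inj₂ (eq , all) = inj₂ (cong suc eq , λ {β′} ρ′ le → extend′ ρ′ le)
          where
          extend′ : ∀ {β′} → Reach d β′ → number β′ ≤ suc u → Avoids v k β′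
          extend′ {β′} ρ′ le with m≤n⇒m<n∨m≡n le
          ... | inj₁ lt = all ρ′ (≤-pred lt)
          ... | inj₂ eq = subst (Avoids v k)
            (number-injective β β′ (reach-sound ρ) (reach-sound ρ′) (trans number≡ (≡-sym eq))) avoids

        ready-start-t : ∀ k {n u t} → ReadyAt (test-t k) (σν n u 0) initialBlock →
                        ∀ w → Holds w (σν n u t) → At m (start-t k) w zero
        ready-start-t k {n} {u} {t} ready w h =
          roundR₁ (start-t k) w zero _ (proj₁ (shape h)) refl refl refl refl
            (subst (λ w → At m (test-t k) w zero) (≡-sym (map-update f w))
              (ready (map f w) holds′ (cells′ , bits′)))
          where
          f : Letter → Letter
          f b = set-counter #t zero (set-bit zero (set-cell (initialCell (origin b)) b))
          f₀ : Letter → Letter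
          f₀ b = set-bit zero (set-cell (initialCell (origin b)) b)
          holds′ : Holds (map f w) (σν n u 0)
          holds′ = subst (λ w′ → Holds w′ (σν n u 0)) (≡-sym (map-∘ w))
            (holds-reset #t (frame {w′ = map f₀ w} h (length-map f₀ w) (≡-sym (map-∘ w)) (λ k → ≡-sym (map-∘ w))))
          cells′ : map cell (map f w) ≡ cellWord start (work initialBlock)
          cells′ = begin
            map cell (map f w)                            ≡⟨ map-∘ w ⟨
            map (initialCell ∘ origin) w                  ≡⟨ map-∘ w ⟩
            map initialCell (map origin w)                ≡⟨ cong (map initialCell) (proj₂ (shape h)) ⟩
            map initialCell originWord                    ≡⟨ map-ʳ++ initialCell (replicate r false) ⟩
            map initialCell (replicate r false) ʳ++ ((blank , just start) ∷ map initialCell (replicate r false))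
              ≡⟨ cong (λ cs → cs ʳ++ ((blank , just start) ∷ cs))
                   (trans (map-replicate initialCell r false) (≡-sym (map-replicate plain r blank))) ⟩
            cellWord start (work initialBlock)            ∎
            where open ≡-Reasoning
          bits′ : map bit (map f w) ≡ bits zero
          bits′ = trans (≡-sym (map-∘ w)) (trans (map-const zero w) (cong (λ l → replicate l zero) (proj₁ (shape h))))

        module _ (k : Choice)
                 (done : ∀ {n u t} → (∀ {β} → Reach d β → Avoids v k β) → Ready (next-choice k) (σν n u t)) where

          -- As c is the true count, n = c refutes a miss. Conversely n ≠ c arises only from a miss,
          -- hence only in mode `every`, where rejecting is allowed.
          ready-test-n : ∀ {n t} → Tally k top n → Ready (test-n k) (σν n 0 t)
          ready-test-n {n} tally w i h =
            test (test-n k) (counter #n) (counter #c) h refl refl refl (small h #n) (small h #c) (value h #n) (value h #c)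
              (λ e → one _ (done (all tally e) w i h)) (λ neq → one _ (rejectable tally neq))
            where
            all : Tally k top n → n ≡ c → ∀ {β} → Reach d β → Avoids v k β
            all (inj₁ (_ , lt))  e   = contradiction lt (≤⇒≯ (≤-reflexive (≡-sym e)))
            all (inj₂ (_ , checked)) e {β} ρ = checked ρ (number≤top β (reach-sound ρ))
            rejectable : Tally k top n → n ≢ c → m ≡ every
            rejectable (inj₁ (e , _))  _   = e
            rejectable (inj₂ (eq , _)) neq = contradiction eq neq

          ready-inc-u : ∀ rem u {n t} → u + rem ≡ top → Tally k u n → Ready (inc-u k) (σν n u t)
          ready-inc-u zero u eq tally with refl ← trans (≡-sym (+-identityʳ u)) eq =
            overflow-then (inc-u k) (test-n k) #u refl refl refl (λ _ → refl) refl (ready-test-n tally)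
          ready-inc-u (suc rem) u {n} {t} eq tally w i h =
            roundR (inc-u k) w i (proj₁ (shape h)) refl refl
              (subst (λ s → Branch m (After m w′ i) (decision (inc-u k) s (symbol i))) (≡-sym (end-incr-< #u h u<))
                choose)
            where
            u< : u < top
            u< = subst (u <_) eq (m<m+n u (s≤s z≤n))
            eq′ = trans (≡-sym (+-suc u rem)) eq
            w′ = out (incr #u) on w
            h′ : Holds w′ (σν n (suc u) t)
            h′ = holds-incr #u h u<
            skipping : Tally k (suc u) n → At m (inc-u k) w′ i
            skipping tally′ = ready-inc-u rem (suc u) eq′ tally′ w′ i h′
            guessing : (m ≡ every ⊎ (m ≡ some × ∃[ β′ ] (Segment d initialBlock β′ × number β′ ≡ suc u))) →
                       At m (rewind k) w′ i
            guessing want = ready-rewind k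
              (ready-start-t k (ready-path k (suc u) d 0 initialBlock refl here want
                λ β ρ number≡ → ready-inc-n k β ρ (≤-<-trans (tally≤ u tally) u<)
                  λ avoids → ready-inc-u rem (suc u) eq′ (tally-hit tally ρ number≡ avoids)))
              w′ i h′
            choose : Branch m (After m w′ i) (decision (inc-u k) off (symbol i))
            -- Mode `every` must deal with both guesses; in mode `some` the decision of `HasNumber`
            -- prescribes the right one.
            choose with mode? | hasNumber? d (suc u)
            ... | inj₁ e | yes has = branch-every e λ where
                  _ (here refl)         → skipping (tally-miss e tally has)
                  _ (there (here refl)) → guessing (inj₁ e)
            ... | inj₁ e | no ¬has = branch-every e λ where
                  _ (here refl)         → skipping (tally-skip tally ¬has)
                  _ (there (here refl)) → guessing (inj₁ e)
            ... | inj₂ e | yes (β , ρ , number≡) =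
                  branch-some e _ (there (here refl)) (guessing (inj₂ (e , β , reach-segment ρ , number≡)))
            ... | inj₂ e | no ¬has = branch-some e _ (here refl) (skipping (tally-skip tally ¬has))

          ready-start-u : ∀ {n u t} → Ready (start-u k) (σν n u t)
          ready-start-u = update-then (start-u k) (inc-u k) _ refl refl refl (λ _ _ → refl)
            (λ {w} h → subst (λ w → Holds w _) (≡-sym (map-∘ w)) (holds-reset #n (holds-reset #u h)))
            -- Number 0 belongs to no configuration, so the empty tally at u = 0 is complete.
            (ready-inc-u top 0 refl (inj₂ (refl , λ {β} ρ le →
              contradiction (number-positive β (reach-sound ρ)) (≤⇒≯ le))))

        -- Induction downwards over the choices; those above i have already been checked at every
        -- configuration of depth d.
        ready-choices : (∀ {n u t} → (∀ {β} → Reach d β → ∀ k → Avoids v k β) → Ready inc-v (σν n u t)) →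
          ∀ i k → toℕ k ≡ i → (∀ {β} → Reach d β → ∀ k′ → i < toℕ k′ → Avoids v k′ β) →
          ∀ {n u t} → Ready (start-u k) (σν n u t)
        ready-choices done i zero refl checked =
          ready-start-u zero λ new → done λ ρ → λ where
            zero    → new ρ
            (suc k) → checked ρ (suc k) (s≤s z≤n)
        ready-choices done (suc i) (suc k) eq checked =
          ready-start-u (suc k) λ new →
            ready-choices done i (inject₁ k) (trans (toℕ-inject₁ k) (suc-injective eq)) λ ρ k′ i< → below new ρ k′ (m≤n⇒m<n∨m≡n i<)
          where
          below : (∀ {β} → Reach d β → Avoids v (suc k) β) →
                  ∀ {β} → Reach d β → ∀ k′ → suc i < toℕ k′ ⊎ suc i ≡ toℕ k′ → Avoids v k′ β
          below new ρ k′ (inj₁ lt) = checked ρ k′ lt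
          below new {β} ρ k′ (inj₂ e) = subst (λ k → Avoids v k β) (toℕ-injective (trans eq e)) (new ρ)

        ready-target : (∀ {n u t} → AllClean d → ¬ HasNumber (suc d) v → Ready inc-v (σν n u t)) →
          ∀ {n u t} → Ready (start-u (fromℕ k-max)) (σν n u t)
        ready-target absent = ready-choices
          (λ all → absent (λ ρ k → proj₁ (all ρ k)) λ { (_ , there ρ k eq , number≡) → proj₂ (all ρ k) eq number≡ })
          _ (fromℕ k-max) refl
          -- No choice lies above `fromℕ k-max`, so the induction starts with nothing checked.
          λ _ k k-max< → contradiction (toℕ<n k) (≤⇒≯ (subst (λ j → suc j ≤ toℕ k) (toℕ-fromℕ k-max) k-max<))

      counted′ : ℕ → ℕ
      counted′ = count (hasNumber? (suc d))

      -- A candidate leaves either through `found`, with a witness, or after a complete pass that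
      -- proves its absence. In both cases c′ keeps up with `counted′`.
      ready-inc-v : (∀ {v n u t} → AllClean d → Ready next-d (regs d c (total (suc d)) v n u t)) →
        ∀ rem v {n u t} → v + rem ≡ top → AllClean d → Ready inc-v (regs d c (counted′ v) v n u t)
      ready-inc-v done zero v eq clean with refl ← trans (≡-sym (+-identityʳ v)) eq =
        overflow-then inc-v next-d #v refl refl refl (λ _ → refl) refl (done clean)
      ready-inc-v done (suc rem) v eq clean =
        incr-then inc-v (start-u (fromℕ k-max)) #v refl refl refl (λ _ → refl) v<
          (Target.ready-target (counted′ v) (suc v) (≤-trans (count≤ (hasNumber? (suc d)) v) (<⇒≤ v<)) v<
            found λ {n} {u} {t} _ ¬has → subst (λ c′ → Ready inc-v (regs d c c′ (suc v) n u t))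
              (count-no (hasNumber? (suc d)) v ¬has) (ready-inc-v done rem (suc v) eq′ clean))
        where
        v< : v < top
        v< = subst (v <_) eq (m<m+n v (s≤s z≤n))
        eq′ = trans (≡-sym (+-suc v rem)) eq
        found : found? (counted′ v) (suc v)
        found {n} {u} {t} has = incr-then inc-c′ inc-v #c′ refl refl refl (λ _ → refl)
          (≤-<-trans (count≤ (hasNumber? (suc d)) v) v<)
          (subst (λ c′ → Ready inc-v (regs d c c′ (suc v) n u t))
            (count-yes (hasNumber? (suc d)) v has) (ready-inc-v done rem (suc v) eq′ clean))

      -- The candidate 0 is never found, so its round checks all successors.
      ready-start-v : (∀ {v n u t} → AllClean d → Ready next-d (regs d c (total (suc d)) v n u t)) →
        ∀ {c′ v n u t} → Ready start-v (regs d c c′ v n u t)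
      ready-start-v done = update-then start-v (start-u (fromℕ k-max)) _ refl refl refl (λ _ _ → refl)
        (λ {w} h → subst (λ w → Holds w _) (≡-sym (map-∘ w)) (holds-reset #c′ (holds-reset #v h)))
        (Target.ready-target 0 0 z≤n z≤n
          (λ { (β , ρ , eq) → contradiction (number-positive β (reach-sound ρ)) (≤⇒≯ (≤-reflexive eq)) })
          λ clean _ → ready-inc-v done top 0 refl clean)

    -- The loop over depths ends because no path of `M` has more than h steps: at depth h + 1 there
    -- is no configuration left.
    ready-test-c : ∀ {h} → (∀ {n κ} → Path n (Computation.initial M x) κ → n ≤ h) →
      (∀ d → (∀ {e} → e < d → AllClean e) → (∀ {β} → ¬ Reach d β) → m ≡ every → Goal) →
      ∀ rem d {c′ v n u t} → d + rem ≡ suc h → (∀ {e} → e < d → AllClean e) →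
      Ready test-c (regs d (total d) c′ v n u t)
    ready-test-c {h} bounded goal rem d {c′} {v} {n} {u} {t} eq clean w i hw =
      test test-c (counter #c) (const zero) hw refl refl refl (small hw #c) z≤n (value hw #c)
        (trans (map-const zero w) (cong (λ l → replicate l zero) (proj₁ (shape hw))))
        (λ e → one _ (goal d clean λ ρ → contradiction (reach-counted ρ) (≤⇒≯ (≤-reflexive e))))
        (λ neq → one _ (next rem eq (proj₂ (total-nonzero d neq))))
      where
      next : ∀ rem → d + rem ≡ suc h → ∀ {β} → Reach d β → At m start-v w i
      next zero eq ρ = contradiction (bounded (proj₁ (proj₂ (reach-path ρ))))
        (<⇒≱ (≤-reflexive (≡-sym (trans (≡-sym (+-identityʳ d)) eq))))
      next (suc rem) eq ρ = Level.ready-start-v d d<top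
        (λ clean-d → update-then next-d inc-d _ refl refl refl (λ _ _ → refl)
          (λ h → holds-assign #c (counter #c′) h (small h #c′) (value h #c′))
          (incr-then inc-d test-c #d refl refl refl (λ _ → refl) d<top
            (ready-test-c bounded goal rem (suc d) (trans (≡-sym (+-suc d rem)) eq) (clean′ clean-d))))
        w i hw
        where
        d<top = reach-depth bounded ρ
        clean′ : AllClean d → ∀ {e} → e < suc d → AllClean e
        clean′ clean-d {e} e<′ with m≤n⇒m<n∨m≡n (≤-pred e<′)
        ... | inj₁ e< = clean e<
        ... | inj₂ refl = clean-d

    ready-restart : ∀ {h} → (∀ {n κ} → Path n (Computation.initial M x) κ → n ≤ h) →
      (∀ d → (∀ {e} → e < d → AllClean e) → (∀ {β} → ¬ Reach d β) → m ≡ every → Goal) →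
      ∀ w i → Shape w → At m restart w i
    ready-restart {h} bounded goal w i (len , org) =
      roundR₁ restart w i _ len refl refl refl refl
        (subst (λ w → At m inc-c w i) (≡-sym (map-update f w))
          (incr-then inc-c test-c #c {ν₀} refl refl refl (λ _ → refl) 0<top
            -- The single increment of c sets it to 1, the number of configurations at depth 0.
            (subst (λ c → Ready test-c (regs 0 c 0 0 0 0 0)) total-0
              (ready-test-c bounded goal (suc h) 0 refl λ ())) (map f w) i cleared))
      where
      ν₀ = regs 0 0 0 0 0 0 0
      f : Letter → Letter
      f b = record b { counters = Vec.replicate 7 zero }
      0<top = <-≤-trans (number-positive initialBlock (reach-sound here)) (number≤top initialBlock (reach-sound here))
      lookup-ν₀ : ∀ k → lookup ν₀ k ≡ 0
      lookup-ν₀ k = lookup-replicate k 0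
      cleared : Holds (map f w) ν₀
      cleared = holds (trans (length-map f w) len , trans (≡-sym (map-∘ w)) org)
        (λ k → trans (≡-sym (map-∘ w)) (trans (map-cong (λ _ → lookup-replicate k zero) w)
          (trans (map-const zero w) (trans (cong (λ l → replicate l zero) len)
            (cong (Digits.numeral width) (≡-sym (lookup-ν₀ k)))))))
        (λ k → ≤-trans (≤-reflexive (lookup-ν₀ k)) z≤n)

-- Growing the block

module Stages {Σ : Set} (Σ-finite : Finite Σ) (M : NTM Σ) (x : List Σ)
              (halts : Computation.Halts M x) (s : ℕ)
              (spaced : ∀ κ → Computation._⟶*_ M x (Computation.initial M x) κ →
                        Computation.space M x κ ≤ s) where
  open Complement Σ-finite M
  open Halting M x
  open Computation M x using (Config; initial; _⟶_; _⟶*_; step; Accepts)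

  -- At this radius no overflow is possible: the first summand accounts for the space of `M`, the
  -- second for the binary input position.
  radius : ℕ
  radius = s + log (suc (length x))

  bound : ℕ
  bound = radius + suc radius + 4

  open Sweep sweeper using (machine; finalWord; module Rounds)
  open Rounds x bound (¬ Accepts)

  module _ (r : ℕ) where
    open Block Σ-finite M x r
    open Numbering Σ-finite M x r

    -- The machine does not know `radius`; it grows only after an overflow, and either cause bounds
    -- the current r. Leaving the block exhibits r + 2 visited cells, and a position that is too
    -- long gives `width ≤ log (n + 1)`.
    overflow-radius : ∀ {d β} j → Reach d β → blockStep j β ≡ overflows → suc r ≤ radius
    overflow-radius j ρ eq with reach-path ρ
    ... | κ , p , f with match-block j f (reach-sound ρ) eq (λ ())
    ...   | κ′ , st , inj₁ r≤ = ≤-trans (n≤1+n _) (≤-trans r≤ (≤-trans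
              (spaced κ′ (path⇒star (p ▷ st))) (m≤m+n s _)))
    ...   | κ′ , st , inj₂ 2^≤ = begin
      suc r                       ≤⟨ m≤n+m (suc r) r ⟩
      width                       ≡⟨ ⌈log₂2^n⌉≡n width ⟨
      log (2 ^ width)             ≤⟨ ⌈log₂⌉-mono-≤ 2^≤ ⟩
      log (suc (length x))        ≤⟨ m≤n+m _ s ⟩
      radius                      ∎
      where open ≤-Reasoning

    reach-accepts : ∀ {d β} j → Reach d β → blockStep j β ≡ accepts → Accepts
    reach-accepts j ρ eq with reach-path ρ
    ... | κ , p , f with match-block j f (reach-sound ρ) eq (λ ())
    ...   | κ′ , st , won = κ′ , path⇒star (p ▷ st) , won

    module _ (m : Mode) (roomy : width + 4 ≤ bound) where
      open Instructions Σ-finite M x r bound (¬ Accepts) m roomy using (Shape)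
      open Loops Σ-finite M x r bound (¬ Accepts) m roomy using (AllClean; dead-end; continued)

      -- Clean levels neither accept nor overflow, so a computation of `M` can be followed in the
      -- block until it rejects. An accepting one would have to reach the empty level d.
      exhausted : ∀ d → (∀ {e} → e < d → AllClean e) → (∀ {β} → ¬ Reach d β) → ¬ Accepts
      exhausted d clean empty (κ , steps , won) = go z≤n here initial-fits steps won
        where
        go : ∀ {e κ κ′ β} → e ≤ d → Reach e β → Fits κ β → κ ⟶* κ′ → Config.state κ′ ≢ accept
        go e≤ ρ (fits _) ε ()
        go e≤ ρ f (st ◅ steps) won with m≤n⇒m<n∨m≡n e≤
        ... | inj₂ refl = empty ρ
        ... | inj₁ e< with match-machine f (reach-sound ρ) st
        ...   | j , match with clean e< ρ j
        go e≤ ρ f (_◅_ {j = κ} st steps) won | inj₁ e< | j , match | dead-end eq =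
          stuck (subst (Match κ) eq match) steps won
          where
          stuck : ∀ {κ κ′} → Config.state κ ≡ reject → κ ⟶* κ′ → Config.state κ′ ≢ accept
          stuck refl ε ()
        go e≤ ρ f (_◅_ {j = κ} st steps) won | inj₁ e< | j , match | continued eq =
          go e< (there ρ j eq) (subst (Match κ) eq match) steps won

  roomy : ∀ {r} → r ≤ radius → r + suc r + 4 ≤ bound
  roomy r≤ = +-monoˡ-≤ 4 (+-mono-≤ r≤ (s≤s r≤))

  extended : ∀ w → finalWord extend w ≡ w ++ (plain-letter ∷ [])
  extended w = begin
    reverse (out skip (end skip on w) (plain-letter ∷ reverse (out skip on w)))
      ≡⟨ cong reverse (out-idle (λ _ → refl) (plain-letter ∷ reverse (out skip on w))) ⟩
    reverse (plain-letter ∷ reverse (out skip on w))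
      ≡⟨ unfold-reverse plain-letter (reverse (out skip on w)) ⟩
    reverse (reverse (out skip on w)) ++ (plain-letter ∷ [])
      ≡⟨ cong (_++ (plain-letter ∷ [])) (trans (reverse-involutive _) (out-idle (λ _ → refl) w)) ⟩
    w ++ (plain-letter ∷ []) ∎
    where open ≡-Reasoning

  replicate-ʳ++ : ∀ {A : Set} (a : A) n {as} → a ∷ (replicate n a ʳ++ as) ≡ replicate n a ʳ++ (a ∷ as)
  replicate-ʳ++ a zero    = refl
  replicate-ʳ++ a (suc n) = replicate-ʳ++ a n

  replicate-++ : ∀ {A : Set} (a : A) n → replicate n a ++ (a ∷ []) ≡ a ∷ replicate n a
  replicate-++ a zero    = refl
  replicate-++ a (suc n) = cong (a ∷_) (replicate-++ a n)

  module _ (m : Mode) (reason : m ≡ every ⊎ (¬ Accepts)) where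

    -- Induction on the extensions left; when none is left, an overflow contradicts
    -- `overflow-radius`.
    stage : ∀ rem r → r + rem ≡ radius → (r≤ : r ≤ radius) →
            ∀ w i → Instructions.Shape Σ-finite M x r bound (¬ Accepts) m (roomy r≤) w → At m restart w i
    stage rem r eq r≤ = Loops.ready-restart Σ-finite M x r bound (¬ Accepts) m (roomy r≤)
      (λ j ρ o → extends rem eq (overflow-radius r j ρ o))
      (λ j ρ a → rejects reason (reach-accepts r j ρ a))
      (proj₂ (paths-bounded initial halts))
      (λ d clean empty _ → exhausted r m (roomy r≤) d clean empty)
      where
      open Instructions Σ-finite M x r bound (¬ Accepts) m (roomy r≤)
      rejects : m ≡ every ⊎ (¬ Accepts) → Accepts → m ≡ every
      rejects (inj₁ e)  _ = e
      rejects (inj₂ ¬a) a = contradiction a ¬a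
      extends : ∀ rem → r + rem ≡ radius → suc r ≤ radius → Extends
      extends zero      eq r<      = contradiction (≤-reflexive (trans (≡-sym eq) (+-identityʳ r))) (<⇒≱ r<)
      extends (suc rem) eq r< w i (len , org) =
        round m extend w i (subst (λ n → n + 4 ≤ bound) (≡-sym len) (roomy r≤))
          (one _ (subst (λ w → At m restart (plain-letter ∷ w) i) (≡-sym (extended w))
            (stage rem (suc r) (trans (≡-sym (+-suc r rem)) eq) r< _ i (len′ , org′))))
        where
        len′ : suc (length (w ++ (plain-letter ∷ []))) ≡ suc r + suc (suc r)
        len′ = cong suc (trans (length-++ w) (trans (+-comm (length w) 1)
          (trans (cong suc len) (≡-sym (+-suc r (suc r))))))
        org′ : false ∷ map origin (w ++ (plain-letter ∷ [])) ≡ replicate (suc r) false ʳ++ (true ∷ replicate (suc r) false)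
        org′ = begin
          false ∷ map origin (w ++ (plain-letter ∷ []))  ≡⟨ cong (false ∷_) (map-++ origin w _) ⟩
          false ∷ (map origin w ++ (false ∷ []))         ≡⟨ cong (λ os → false ∷ (os ++ (false ∷ []))) org ⟩
          false ∷ ((replicate r false ʳ++ (true ∷ replicate r false)) ++ (false ∷ []))
            ≡⟨ cong (false ∷_) (trans (cong (_++ (false ∷ [])) (ʳ++-defn (replicate r false)))
                 (trans (++-assoc (reverse (replicate r false)) _ _)
                   (trans (cong (λ os → reverse (replicate r false) ++ (true ∷ os)) (replicate-++ false r))
                          (≡-sym (ʳ++-defn (replicate r false)))))) ⟩
          false ∷ (replicate r false ʳ++ (true ∷ replicate (suc r) false))  ≡⟨ replicate-ʳ++ false r ⟩
          replicate (suc r) false ʳ++ (true ∷ replicate (suc r) false)      ∎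
          where open ≡-Reasoning

    initial-wins : Wins m (Computation.initial machine x)
    -- From the blank tape `boot` makes the one-letter word marked as origin, which is the block of
    -- radius 0.
    initial-wins = round m boot [] zero (m≤n+m 4 _)
      (Instructions.one Σ-finite M x 0 bound (¬ Accepts) m (roomy z≤n) _
        (stage radius 0 refl z≤n _ zero (refl , refl)))
      false false

-- The space bound and closure under complement

module _ {Σ : Set} (Σ-finite : Finite Σ) {S : ℕ → ℕ} (log∈O : S ∈Ω log) where

  -- Passing from n to 2n ≥ n + 1 raises the logarithm by 1, and 1 ≤ log n once n ≥ 2.
  log-suc : ∀ n → 2 ≤ n → log (suc n) ≤ log n + log n
  log-suc n@(suc _) 2≤n = begin
    log (suc n)      ≤⟨ ⌈log₂⌉-mono-≤ (≤-trans (+-monoˡ-≤ n (<⇒≤ 2≤n)) (≤-reflexive (cong (n +_) (≡-sym (+-identityʳ n))))) ⟩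
    log (2 * n)      ≡⟨ ⌈log₂2*n⌉≡1+⌈log₂n⌉ n ⟩
    1 + log n        ≤⟨ +-monoˡ-≤ (log n) (⌈log₂⌉-mono-≤ 2≤n) ⟩
    log n + log n    ∎
    where open ≤-Reasoning

  -- For a radius ρ the bound is 2ρ + 5. Here ρ ≤ (a + 2b) S(n), and 1 ≤ log n ≤ b S(n) absorbs the
  -- constant, which gives the factor 2(a + 2b) + 5b = 2a + 9b.
  bound∈O : ∀ {s} → s ∈O S → (λ n → (s n + log (suc n)) + suc (s n + log (suc n)) + 4) ∈O S
  bound∈O {s} (a , n₁ , s≤) = 2 * a + 9 * b , n₁ + n₂ + 2 , λ n n≥ →
    let open ≤-Reasoning
        2≤n  = ≤-trans (m≤n+m 2 (n₁ + n₂)) n≥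
        sₙ≤  = s≤ n (≤-trans (m≤m+n n₁ n₂) (≤-trans (m≤m+n (n₁ + n₂) 2) n≥))
        log≤ₙ = log≤ n (≤-trans (m≤n+m n₂ n₁) (≤-trans (m≤m+n (n₁ + n₂) 2) n≥))
        r≤   = +-mono-≤ sₙ≤ (≤-trans (log-suc n 2≤n) (+-mono-≤ log≤ₙ log≤ₙ))
        1≤   = ≤-trans (⌈log₂⌉-mono-≤ 2≤n) log≤ₙ
    in begin
      (s n + log (suc n)) + suc (s n + log (suc n)) + 4
        ≡⟨ solve 1 (λ r → r :+ (con 1 :+ r) :+ con 4 := con 2 :* r :+ con 5 :* con 1) refl (s n + log (suc n)) ⟩
      2 * (s n + log (suc n)) + 5 * 1
        ≤⟨ +-mono-≤ (*-monoʳ-≤ 2 r≤) (*-monoʳ-≤ 5 1≤) ⟩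
      2 * (a * S n + (b * S n + b * S n)) + 5 * (b * S n)
        ≡⟨ solve 3 (λ a b m → con 2 :* (a :* m :+ (b :* m :+ b :* m)) :+ con 5 :* (b :* m)
                            := (con 2 :* a :+ con 9 :* b) :* m) refl a b (S n) ⟩
      (2 * a + 9 * b) * S n ∎
    where
    open +-*-Solver
    b    = proj₁ log∈O
    n₂   = proj₁ (proj₂ log∈O)
    log≤ = proj₂ (proj₂ log∈O)

  -- Mode `every` supplies termination, the space bound and the soundness of acceptance. Mode `some`
  -- is used only for inputs outside `L`, where `M` has no accepting path that could force a
  -- rejection.
  complement-closed : (L : Language Σ) → L ∈ NSPACE S → ∁ L ∈ NSPACE S
  complement-closed L (M , halts , (s , s∈O , spaced) , L⊆ , L⊇) =
    Sweep.machine (Complement.sweeper Σ-finite M)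
    , (λ x → At.safe-halts x (safe x))
    , (_ , bound∈O s∈O , λ x κ steps → At.safe-space x (At.safe-reach x (safe x) steps))
    , (λ {x} x∉ → Stages.initial-wins Σ-finite M x (halts x) (s (length x)) (spaced x) some
                    (inj₂ λ a → x∉ (L⊇ a)))
    , (λ {x} (κ , steps , won) x∈ → At.safe-accept x (At.safe-reach x (safe x) steps) won (L⊆ x∈))
    where
    module At (x : List Σ) = Sweep.Rounds (Complement.sweeper Σ-finite M) x
      (Stages.bound Σ-finite M x (halts x) (s (length x)) (spaced x)) (¬ Computation.Accepts M x)
    safe : ∀ x → At.Safe x (Computation.initial (Sweep.machine (Complement.sweeper Σ-finite M)) x)
    safe x = Stages.initial-wins Σ-finite M x (halts x) (s (length x)) (spaced x) every (inj₁ refl)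

-- A halting machine has a finite computation tree, so acceptance is decidable by search and double
-- negation can be removed constructively. This makes `L` the complement of `∁ L`.
NSPACE-stable : {Σ : Set} {S : ℕ → ℕ} {L : Language Σ} → L ∈ NSPACE S → ∀ {x} → ¬ (¬ L x) → L x
NSPACE-stable (M , halts , _ , L⊆ , L⊇) {x} ¬¬x with Halting.acceptable? M x _ (halts x)
... | yes a = L⊇ a
... | no ¬a = contradiction (λ x∈ → ¬a (L⊆ x∈)) ¬¬x

theorem2p28 : (Σ : Set) → Finite Σ → (S : ℕ → ℕ) → S ∈Ω log →
    ((L : Language Σ) → L ∈ NSPACE S → ∁ L ∈ NSPACE S)
    × (NSPACE {Σ} S ≐ co-NSPACE {Σ} S)
theorem2p28 Σ Σ-finite S log∈O = closed
  , (λ {L} L∈ → ∁ L , closed L L∈ , (λ x∈ x∉ → x∉ x∈) , NSPACE-stable {L = L} L∈)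
  , λ { {L} (L′ , L′∈ , L⊆ , L⊇) → transfer (closed L′ L′∈) (L⊆ , L⊇) }
  where
  closed : (L : Language Σ) → L ∈ NSPACE S → ∁ L ∈ NSPACE S
  closed = complement-closed Σ-finite log∈O
  transfer : {L L₁ : Language Σ} → L₁ ∈ NSPACE S → L ≐ L₁ → L ∈ NSPACE S
  transfer (M , halts , bounded , L₁⊆ , L₁⊇) (L⊆ , L⊇) =
    M , halts , bounded , (λ x∈ → L₁⊆ (L⊆ x∈)) , (λ a → L⊇ (L₁⊇ a))
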